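{- Let $\sigma$ be a layered permutation with layers of sizes $(\ell_1,\dots,\ell_k)$, $k\ge 2$. If $\ell_1=\ell_k\ge 2$ and for every $i\in[k-1]$ at least one of $\ell_i,\ell_{i+1}$ equals $\ell_1$, then there exists an integer $K\in\mathbb{N}$ such that every $\sigma$-optimal layered permutation has at most $K$ layers.
   Context: A permutation of order $n$ is a bijection $\pi:[n]\to[n]$; the density $d(\sigma,\pi)$ of $\sigma$ in $\pi$ (for $|\pi|\ge|\sigma|$) is the probability that $|\sigma|$ uniformly random distinct positions $i_1<\cdots<i_{|\sigma|}$ of $\pi$ induce $\sigma$, i.e. $\pi(i_j)<\pi(i_{j'})$ iff $\sigma(j)<\sigma(j')$. A permutation $\sigma$ of order $m$ is layered with layers of sizes $(\ell_1,\ldots,\ell_k)$ if $[m]$ is partitioned into consecutive intervals $I_1,\ldots,I_k$ (in order) with $|I_j|=\ell_j$, $\sigma$ decreasing on each $I_j$, and $\sigma(x)<\sigma(x')$ for $x\in I_j,x'\in I_{j'}$, $j<j'$. A permutation $\pi$ with $|\pi|\ge|\sigma|$ is $\sigma$-optimal if $d(\sigma,\pi)\ge d(\sigma,\pi')$ for every permutation $\pi'$ of order $|\pi|$. -}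

module Defs where

open import Data.Nat as ℕ using (ℕ; zero; suc; _+_; _∸_; _<ᵇ_; _≤_; _<_)
open import Data.Nat.Combinatorics using (_C_)
open import Data.Fin using (Fin; toℕ)
open import Data.Fin.Permutation using (Permutation′; _⟨$⟩ʳ_)
open import Data.Vec using (Vec; []; _∷_; lookup)
open import Data.List using (List; []; _∷_; _++_; map; filterᵇ; length; allFin)
open import Data.Bool.ListAction using (all)
open import Data.Nat.ListAction using (sum)
open import Data.List.Relation.Unary.All using (All)
open import Data.Bool using (Bool; true; false; if_then_else_; _∧_)
open import Data.Integer using (+_)
open import Data.Rational using (ℚ; 0ℚ; _/_) renaming (_≤_ to _≤ℚ_)
open import Data.Product using (_×_)
open import Relation.Binary.PropositionalEquality using (_≡_)

Perm : ℕ → Set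
Perm n = Permutation′ n

choose : {A : Set} (m : ℕ) → List A → List (Vec A m)
choose zero    xs       = [] ∷ []
choose (suc m) []       = []
choose (suc m) (x ∷ xs) = map (x ∷_) (choose m xs) ++ choose (suc m) xs

_==ᵇ_ : Bool → Bool → Bool
true  ==ᵇ b = b
false ==ᵇ true  = false
false ==ᵇ false = true

induces : {m n : ℕ} → Perm m → Perm n → Vec (Fin n) m → Bool
induces {m} σ π v =
  all (λ j → all (λ j' →
        (toℕ (π ⟨$⟩ʳ lookup v j) <ᵇ toℕ (π ⟨$⟩ʳ lookup v j'))
          ==ᵇ (toℕ (σ ⟨$⟩ʳ j) <ᵇ toℕ (σ ⟨$⟩ʳ j')))
      (allFin m))
    (allFin m)

occurrences : {m n : ℕ} → Perm m → Perm n → ℕ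
occurrences {m} {n} σ π = length (filterᵇ (induces σ π) (choose m (allFin n)))

-- Density d(σ, π) = occurrences / (n choose m)  (meaningful for n ≥ m,
-- where n choose m > 0; the value 0 in the other case is never used).
density : {m n : ℕ} → Perm m → Perm n → ℚ
density {m} {n} σ π with n C m
... | zero  = 0ℚ
... | suc c = (+ occurrences σ π) / suc c

Optimal : {m n : ℕ} → Perm m → Perm n → Set
Optimal {m} {n} σ π = m ≤ n × ((π' : Perm n) → density σ π' ≤ℚ density σ π)

blockOf : List ℕ → ℕ → ℕ
blockOf []       x = 0
blockOf (l ∷ ls) x = if x <ᵇ l then 0 else suc (blockOf ls (x ∸ l))

IsLayered : {m : ℕ} → Perm m → List ℕ → Set
IsLayered {m} σ ℓs =
  sum ℓs ≡ m × All (1 ≤_) ℓs ×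
  ((x x' : Fin m) → toℕ x < toℕ x' →
     (blockOf ℓs (toℕ x) ≡ blockOf ℓs (toℕ x') → toℕ (σ ⟨$⟩ʳ x') < toℕ (σ ⟨$⟩ʳ x)) ×
     (blockOf ℓs (toℕ x) < blockOf ℓs (toℕ x') → toℕ (σ ⟨$⟩ʳ x) < toℕ (σ ⟨$⟩ʳ x')))

{-# OPTIONS --safe #-}

-- Let a be the size of the first and last layers of σ. In a layered permutation with
-- layer sizes p₁, …, p_N the occurrences of σ number Σ Π C(p_{i_j}, ℓ_j) over
-- i₁ < ⋯ < i_k. In an optimum of order n a fixed fraction of n^m embeddings exists, and
-- each layer takes part in at least its proportional share of them: otherwise it would
-- pay to add its points to another layer. A layer that is light compared with n can host
-- that many occurrences only as layers of size one, which lie between two layers of size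
-- a. If there are too many layers, some long run of consecutive layers is light
-- in total, and in that run some block of a layers is light compared with the part of the
-- run on one side of it. Merging this block to a single layer gains more occurrences, with
-- the merged layer as a layer of size a next to a point of that side as layer of size
-- one, than it loses, since any two consecutive layers of σ hosted within the block
-- include one of size a. This contradicts optimality.
module Submission where

open import Defs
open import Data.Nat using (ℕ; zero; suc; _+_; _*_; _∸_; _^_; _≤_; _<_; z≤n; s≤s; s≤s⁻¹; NonZero; >-nonZero; _<ᵇ_; _≡ᵇ_)
open import Data.Nat.Combinatorics using (_C_; nCk+nC[k+1]≡[n+1]C[k+1]; nC1≡n)
open import Data.Nat.DivMod using (_/_; _%_; m≡m%n+[m/n]*n; m%n<n; m≥n⇒m/n>0)
open import Data.Nat.ListAction using (sum)
open import Data.Nat.ListAction.Properties using (sum-++)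
open import Data.Nat.Properties
open import Data.Nat.Tactic.RingSolver using (solve-∀)
import Data.Integer as ℤ
import Data.Integer.Properties as ℤ
import Data.Rational as ℚ
import Data.Rational.Properties as ℚ
import Data.Rational.Unnormalised as ℚᵘ
import Data.Rational.Unnormalised.Properties as ℚᵘ
open import Data.Bool using (Bool; true; false; not; _∧_; if_then_else_)
open import Data.Bool.ListAction using (all)
open import Data.Bool.Properties using (⇔→≡; not-injective; T-≡)
open import Data.Fin using (Fin; inject₁) renaming (suc to fsuc)
open import Data.Fin as Fin using (zero; suc; toℕ; _↑ˡ_; _↑ʳ_; splitAt; opposite)
open import Data.Fin.Permutation using (reverse; _⟨$⟩ʳ_)
open import Data.Fin.Properties using (splitAt-↑ˡ; splitAt-↑ʳ; splitAt⁻¹-↑ˡ; splitAt⁻¹-↑ʳ; toℕ-↑ˡ; toℕ-↑ʳ; toℕ<n; opposite-prop; +↔⊎; toℕ-injective)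
open import Data.List using (List; []; _∷_; _++_; length; [_]; map; take; drop; filterᵇ; replicate; allFin; tabulate; initLast; _∷ʳ′_)
open import Data.List.Properties using (++-assoc; ++-identityʳ; length-take; length-drop; take++drop≡id; ∷ʳ-injectiveʳ; map-++; map-∘; map-tabulate; tabulate-cong)
open import Data.List.Relation.Unary.All as All using (All; []; _∷_)
open import Data.List.Relation.Unary.All.Properties using (++⁺; ++⁻ˡ; ++⁻ʳ; map⁺)
open import Data.List.Relation.Unary.AllPairs using (AllPairs; []; _∷_)
import Data.List.Relation.Unary.AllPairs.Properties as AllPairs
open import Data.List.Relation.Unary.Linked using (Linked; []; [-]; _∷_)
open import Data.Vec as Vec using (Vec; []; _∷_; lookup; head; last; toList)
open import Data.Vec.Properties using (lookup-map)
open import Data.Empty using (⊥; ⊥-elim)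
open import Data.Product using (_×_; _,_; ∃-syntax; proj₁; proj₂)
open import Data.Sum using (_⊎_; inj₁; inj₂)
open import Data.Sum.Function.Propositional using (_⊎-↔_)
open import Function using (_∘_; id; case_of_; _⇔_; mk⇔; Equivalence)
open import Function.Construct.Composition using (_↔-∘_)
open import Function.Construct.Identity using (↔-id)
open import Function.Construct.Symmetry using (↔-sym)
open import Relation.Binary.Definitions using (tri<; tri≈; tri>)
open import Relation.Binary.PropositionalEquality using (_≡_; _≢_; refl; sym; trans; cong; cong₂; subst; subst₂)
open import Relation.Nullary using (¬_)
open ≤-Reasoning

-- Binomial coefficients

-- The obstacle is that merging layers x and y destroys the occurrences that host two consecutive
-- pattern layers in them. Loss and gain are therefore both measured in one quantity, the number
-- `surplus a x y` of a-subsets of the merged layer that meet both parts. As one of two consecutive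
-- pattern layers has size a, the loss is at most a constant times (x + y) n^(m-a-1)
-- `surplus a x y`. The gain is at least `surplus a x y` times the number of ways to host the rest
-- of the pattern, which is of order S n^(m-a-1) when a side of weight S hosts the layer of size
-- one. The surplus cancels, and merging pays once S exceeds a constant times the weight of what is
-- merged. The surplus vanishes while x + y < a, which is why whole blocks of a layers are merged:
-- they contain at least a points. The heavy side may be either one, which is harmless because ℓ₁ =
-- ℓ_k ≥ 2 puts a layer of size a on both sides of every layer of size one, and the block can play
-- either of them. All estimates are multiplied out, so that they stay in ℕ.

pascal : ∀ n k → suc n C suc k ≡ n C k + n C suc k
pascal n k = sym (nCk+nC[k+1]≡[n+1]C[k+1] n k)

C-monoˡ-step : ∀ n k → n C k ≤ suc n C k
C-monoˡ-step n zero    = ≤-refl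
C-monoˡ-step n (suc k) = ≤-trans (m≤n+m (n C suc k) (n C k)) (≤-reflexive (sym (pascal n k)))

C-monoˡ-+ : ∀ x y k → y C k ≤ (x + y) C k
C-monoˡ-+ zero    y k = ≤-refl
C-monoˡ-+ (suc x) y k = ≤-trans (C-monoˡ-+ x y k) (C-monoˡ-step (x + y) k)

C-monoˡ : ∀ {x y} k → x ≤ y → x C k ≤ y C k
C-monoˡ {x} {y} k x≤y = subst (λ z → x C k ≤ z C k) (m∸n+n≡m x≤y) (C-monoˡ-+ (y ∸ x) x k)

C-positive : ∀ n k → k ≤ n → 1 ≤ n C k
C-positive n       zero    _         = ≤-refl
C-positive (suc n) (suc k) (s≤s k≤n) =
  ≤-trans (C-positive n k k≤n) (≤-trans (m≤m+n (n C k) (n C suc k)) (≤-reflexive (sym (pascal n k))))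

C-suc≤ : ∀ n k → n C suc k ≤ n * (n C k)
C-suc≤ zero    k = z≤n
C-suc≤ (suc n) k = begin
  suc n C suc k           ≡⟨ pascal n k ⟩
  n C k + n C suc k       ≤⟨ +-monoʳ-≤ (n C k) (C-suc≤ n k) ⟩
  n C k + n * (n C k)     ≤⟨ *-monoʳ-≤ (suc n) (C-monoˡ-step n k) ⟩
  suc n * (suc n C k)     ∎

C≤^ : ∀ n k → n C k ≤ n ^ k
C≤^ n zero    = ≤-refl
C≤^ n (suc k) = ≤-trans (C-suc≤ n k) (*-monoʳ-≤ n (C≤^ n k))

C-+-lower : ∀ x y k → x C suc k + y * (x C k) ≤ (x + y) C suc k
C-+-lower x zero    k = ≤-reflexive (trans (+-identityʳ _) (cong (_C suc k) (sym (+-identityʳ x))))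
C-+-lower x (suc y) k = begin
  x C suc k + (x C k + y * (x C k))      ≡⟨ swap (x C suc k) (x C k) (y * (x C k)) ⟩
  x C k + (x C suc k + y * (x C k))      ≤⟨ +-mono-≤ (C-monoˡ k (m≤m+n x y)) (C-+-lower x y k) ⟩
  (x + y) C k + (x + y) C suc k          ≡⟨ sym (pascal (x + y) k) ⟩
  suc (x + y) C suc k                    ≡⟨ cong (_C suc k) (sym (+-suc x y)) ⟩
  (x + suc y) C suc k                    ∎
  where
  swap : ∀ a b c → a + (b + c) ≡ b + (a + c)
  swap = solve-∀

C-super : ∀ x y k → x C suc k + y C suc k ≤ (x + y) C suc k
C-super x zero    k = ≤-reflexive (trans (+-identityʳ _) (cong (_C suc k) (sym (+-identityʳ x))))
C-super x (suc y) k = begin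
  x C suc k + suc y C suc k              ≡⟨ cong (x C suc k +_) (pascal y k) ⟩
  x C suc k + (y C k + y C suc k)        ≡⟨ swap (x C suc k) (y C k) (y C suc k) ⟩
  y C k + (x C suc k + y C suc k)        ≤⟨ +-mono-≤ (C-monoˡ-+ x y k) (C-super x y k) ⟩
  (x + y) C k + (x + y) C suc k          ≡⟨ sym (pascal (x + y) k) ⟩
  suc (x + y) C suc k                    ≡⟨ cong (_C suc k) (sym (+-suc x y)) ⟩
  (x + suc y) C suc k                    ∎
  where
  swap : ∀ a b c → a + (b + c) ≡ b + (a + c)
  swap = solve-∀

-- Three disjoint families of subsets: inside x, inside y, and with exactly one point in y. The last
-- two are disjoint because the subsets have at least two points.
C-super-lower : ∀ x y k →
  x C suc (suc k) + y C suc (suc k) + y * (x C suc k) ≤ (x + y) C suc (suc k)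
C-super-lower x zero    k = ≤-reflexive (trans (trans (+-identityʳ _) (+-identityʳ _))
                                       (cong (_C suc (suc k)) (sym (+-identityʳ x))))
C-super-lower x (suc y) k = begin
  x C suc (suc k) + suc y C suc (suc k) + (x C suc k + y * (x C suc k))
    ≡⟨ cong (λ t → x C suc (suc k) + t + (x C suc k + y * (x C suc k))) (pascal y (suc k)) ⟩
  x C suc (suc k) + (y C suc k + y C suc (suc k)) + (x C suc k + y * (x C suc k))
    ≡⟨ swap (x C suc (suc k)) (y C suc k) (y C suc (suc k)) (x C suc k) (y * (x C suc k)) ⟩
  (x C suc k + y C suc k) + (x C suc (suc k) + y C suc (suc k) + y * (x C suc k))
    ≤⟨ +-mono-≤ (C-super x y k) (C-super-lower x y k) ⟩
  (x + y) C suc k + (x + y) C suc (suc k) ≡⟨ sym (pascal (x + y) (suc k)) ⟩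
  suc (x + y) C suc (suc k)               ≡⟨ cong (_C suc (suc k)) (sym (+-suc x y)) ⟩
  (x + suc y) C suc (suc k)               ∎
  where
  swap : ∀ a b c d e → a + (b + c) + (d + e) ≡ (d + b) + (a + c + e)
  swap = solve-∀

C-super-strict : ∀ x y k → 1 ≤ x → 1 ≤ y → suc (suc k) ≤ x + y →
  x C suc (suc k) + y C suc (suc k) < (x + y) C suc (suc k)
C-super-strict (suc x) (suc y) k _ _ k≤ = begin-strict
  suc x C suc (suc k) + suc y C suc (suc k)
    ≡⟨ cong (suc x C suc (suc k) +_) (pascal y (suc k)) ⟩
  suc x C suc (suc k) + (y C suc k + y C suc (suc k))
    ≡⟨ swap (suc x C suc (suc k)) (y C suc k) (y C suc (suc k)) ⟩
  y C suc k + (suc x C suc (suc k) + y C suc (suc k))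
    <⟨ +-mono-<-≤ gap (C-super (suc x) y (suc k)) ⟩
  (suc x + y) C suc k + (suc x + y) C suc (suc k) ≡⟨ sym (pascal (suc x + y) (suc k)) ⟩
  suc (suc x + y) C suc (suc k)                   ≡⟨ cong (_C suc (suc k)) (sym (+-suc (suc x) y)) ⟩
  (suc x + suc y) C suc (suc k)                   ∎
  where
  swap : ∀ a b c → a + (b + c) ≡ b + (a + c)
  swap = solve-∀
  gap : y C suc k < (suc x + y) C suc k
  gap = begin-strict
    y C suc k                     <⟨ +-mono-≤ (C-positive (x + y) k (s≤s⁻¹ (s≤s⁻¹ (subst (suc (suc k) ≤_) (+-suc (suc x) y) k≤)))) (C-monoˡ-+ x y (suc k)) ⟩
    (x + y) C k + (x + y) C suc k ≡⟨ sym (pascal (x + y) k) ⟩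
    suc (x + y) C suc k           ∎

-- For l ≥ 1 the quotient C (z, l) / z does not decrease in z; this is that fact cross-multiplied.
C-ratio : ∀ z x k → (z + x) * (z C suc k) ≤ z * ((z + x) C suc k)
C-ratio z x k = begin
  (z + x) * (z C suc k)                    ≡⟨ *-distribʳ-+ (z C suc k) z x ⟩
  z * (z C suc k) + x * (z C suc k)        ≤⟨ +-monoʳ-≤ (z * (z C suc k)) (*-monoʳ-≤ x (C-suc≤ z k)) ⟩
  z * (z C suc k) + x * (z * (z C k))      ≡⟨ rearr z x (z C suc k) (z C k) ⟩
  z * (z C suc k + x * (z C k))            ≤⟨ *-monoʳ-≤ z (C-+-lower z x k) ⟩
  z * ((z + x) C suc k)                    ∎
  where
  rearr : ∀ z x p q → z * p + x * (z * q) ≡ z * (p + x * q)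
  rearr = solve-∀

-- Pick one point from each of k groups of t points.
^≤C : ∀ t k → t ^ k ≤ (k * t) C k
^≤C t zero    = ≤-refl
^≤C t (suc k) = begin
  t * t ^ k                                  ≤⟨ *-monoʳ-≤ t (^≤C t k) ⟩
  t * ((k * t) C k)                          ≤⟨ m≤n+m _ ((k * t) C suc k) ⟩
  (k * t) C suc k + t * ((k * t) C k)        ≤⟨ C-+-lower (k * t) t k ⟩
  (k * t + t) C suc k                        ≡⟨ cong (_C suc k) (+-comm (k * t) t) ⟩
  (t + k * t) C suc k                        ∎

^-super : ∀ x y k → x ^ suc k + y ^ suc k ≤ (x + y) ^ suc k
^-super x y zero    = ≤-reflexive (trans (cong₂ _+_ (*-identityʳ x) (*-identityʳ y)) (sym (*-identityʳ (x + y))))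
^-super x y (suc k) = begin
  x * x ^ suc k + y * y ^ suc k
    ≤⟨ +-mono-≤ (*-monoˡ-≤ (x ^ suc k) (m≤m+n x y)) (*-monoˡ-≤ (y ^ suc k) (m≤n+m y x)) ⟩
  (x + y) * x ^ suc k + (x + y) * y ^ suc k  ≡⟨ sym (*-distribˡ-+ (x + y) (x ^ suc k) (y ^ suc k)) ⟩
  (x + y) * (x ^ suc k + y ^ suc k)          ≤⟨ *-monoʳ-≤ (x + y) (^-super x y k) ⟩
  (x + y) * (x + y) ^ suc k                  ∎

-- Occurrences of layered patterns

-- The recursion asks whether the first host layer hosts the first pattern layer. That this is the
-- number of occurrences is `occurrences≡count`.
count : List ℕ → List ℕ → ℕ
count []       ps       = 1
count (l ∷ ls) []       = 0
count (l ∷ ls) (p ∷ ps) = (p C l) * count ls ps + count (l ∷ ls) ps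

sumSplits : (List ℕ → List ℕ → ℕ) → List ℕ → ℕ
sumSplits φ []       = φ [] []
sumSplits φ (l ∷ ls) = φ [] (l ∷ ls) + sumSplits (λ u → φ (l ∷ u)) ls

sumSplits-zero : ∀ ls → sumSplits (λ _ _ → 0) ls ≡ 0
sumSplits-zero []       = refl
sumSplits-zero (l ∷ ls) = sumSplits-zero ls

sumSplits-cong : ∀ {φ ψ} → (∀ u v → φ u v ≡ ψ u v) → ∀ ls → sumSplits φ ls ≡ sumSplits ψ ls
sumSplits-cong eq []       = eq [] []
sumSplits-cong eq (l ∷ ls) = cong₂ _+_ (eq [] (l ∷ ls)) (sumSplits-cong (λ u → eq (l ∷ u)) ls)

sumSplits-+ : ∀ φ ψ ls →
  sumSplits (λ u v → φ u v + ψ u v) ls ≡ sumSplits φ ls + sumSplits ψ ls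
sumSplits-+ φ ψ []       = refl
sumSplits-+ φ ψ (l ∷ ls) = trans
  (cong (φ [] (l ∷ ls) + ψ [] (l ∷ ls) +_) (sumSplits-+ (λ u → φ (l ∷ u)) (λ u → ψ (l ∷ u)) ls))
  (swap (φ [] (l ∷ ls)) (ψ [] (l ∷ ls)) _ _)
  where
  swap : ∀ a b c d → a + b + (c + d) ≡ a + c + (b + d)
  swap = solve-∀

sumSplits-* : ∀ c φ ls → sumSplits (λ u v → c * φ u v) ls ≡ c * sumSplits φ ls
sumSplits-* c φ []       = refl
sumSplits-* c φ (l ∷ ls) = trans
  (cong (c * φ [] (l ∷ ls) +_) (sumSplits-* c (λ u → φ (l ∷ u)) ls))
  (sym (*-distribˡ-+ c (φ [] (l ∷ ls)) _))

term≤sumSplits : ∀ φ u v → φ u v ≤ sumSplits φ (u ++ v)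
term≤sumSplits φ []      []      = ≤-refl
term≤sumSplits φ []      (l ∷ v) = m≤m+n _ _
term≤sumSplits φ (l ∷ u) v       =
  ≤-trans (term≤sumSplits (λ u → φ (l ∷ u)) u v) (m≤n+m _ _)

sumSplits-pigeonhole : ∀ φ ls →
  ∃[ u ] ∃[ v ] (ls ≡ u ++ v × sumSplits φ ls ≤ suc (length ls) * φ u v)
sumSplits-pigeonhole φ []       = [] , [] , refl , m≤m+n _ _
sumSplits-pigeonhole φ (l ∷ ls) with sumSplits-pigeonhole (λ u → φ (l ∷ u)) ls
... | u , v , eq , bound with ≤-total (φ [] (l ∷ ls)) (φ (l ∷ u) v)
...   | inj₁ small = l ∷ u , v , cong (l ∷_) eq , +-mono-≤ small bound
...   | inj₂ large = [] , l ∷ ls , refl ,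
        +-monoʳ-≤ (φ [] (l ∷ ls)) (≤-trans bound (*-monoʳ-≤ (suc (length ls)) large))

-- Cutting the host list cuts every embedding into a prefix of the pattern hosted in A and a suffix
-- hosted in B.
count-++ : ∀ ls A B → count ls (A ++ B) ≡ sumSplits (λ u v → count u A * count v B) ls
count-++ []       []      B = refl
count-++ (l ∷ ls) []      B = sym (trans
  (cong (1 * count (l ∷ ls) B +_) (sumSplits-zero ls))
  (trans (+-identityʳ _) (*-identityˡ _)))
count-++ []       (p ∷ A) B = refl
count-++ (l ∷ ls) (p ∷ A) B = begin-equality
  (p C l) * count ls (A ++ B) + count (l ∷ ls) (A ++ B)
    ≡⟨ cong₂ (λ s t → (p C l) * s + t) (count-++ ls A B) (count-++ (l ∷ ls) A B) ⟩
  (p C l) * sumSplits (λ u v → count u A * count v B) ls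
    + (1 * count (l ∷ ls) B + sumSplits (λ u v → count (l ∷ u) A * count v B) ls)
    ≡⟨ cong (_+ (1 * count (l ∷ ls) B + sumSplits (λ u v → count (l ∷ u) A * count v B) ls))
         (sym (sumSplits-* (p C l) (λ u v → count u A * count v B) ls)) ⟩
  sumSplits (λ u v → (p C l) * (count u A * count v B)) ls
    + (1 * count (l ∷ ls) B + sumSplits (λ u v → count (l ∷ u) A * count v B) ls)
    ≡⟨ swap (sumSplits (λ u v → (p C l) * (count u A * count v B)) ls) (1 * count (l ∷ ls) B) _ ⟩
  1 * count (l ∷ ls) B + (sumSplits (λ u v → (p C l) * (count u A * count v B)) ls
                          + sumSplits (λ u v → count (l ∷ u) A * count v B) ls)
    ≡⟨ cong (1 * count (l ∷ ls) B +_) (sym (sumSplits-+ (λ u v → (p C l) * (count u A * count v B)) (λ u v → count (l ∷ u) A * count v B) ls)) ⟩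
  1 * count (l ∷ ls) B
    + sumSplits (λ u v → (p C l) * (count u A * count v B) + count (l ∷ u) A * count v B) ls
    ≡⟨ cong (1 * count (l ∷ ls) B +_)
         (sumSplits-cong (λ u v → dist (p C l) (count u A) (count v B) (count (l ∷ u) A)) ls) ⟩
  1 * count (l ∷ ls) B + sumSplits (λ u v → count (l ∷ u) (p ∷ A) * count v B) ls ∎
  where
  swap : ∀ a b c → a + (b + c) ≡ b + (a + c)
  swap = solve-∀
  dist : ∀ c x y z → c * (x * y) + z * y ≡ (c * x + z) * y
  dist = solve-∀

count-super : ∀ u v A B → count u A * count v B ≤ count (u ++ v) (A ++ B)
count-super u v A B = ≤-trans (term≤sumSplits (λ u v → count u A * count v B) u v)
                              (≤-reflexive (sym (count-++ (u ++ v) A B)))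

count-++ˡ : ∀ ls A B → count ls B ≤ count ls (A ++ B)
count-++ˡ ls A B = subst (_≤ count ls (A ++ B)) (*-identityˡ _) (count-super [] ls A B)

count-++ʳ : ∀ ls A B → count ls A ≤ count ls (A ++ B)
count-++ʳ ls A B = subst (_≤ count ls (A ++ B)) (*-identityʳ _)
  (subst (λ w → count ls A * 1 ≤ count w (A ++ B)) (++-identityʳ ls) (count-super ls [] A B))

count-[1] : ∀ ps → count [ 1 ] ps ≡ sum ps
count-[1] []       = refl
count-[1] (p ∷ ps) = cong₂ _+_ (trans (*-identityʳ _) (nC1≡n p)) (count-[1] ps)

count≤ : ∀ {ls} → All (1 ≤_) ls → ∀ ps {n} → sum ps ≤ n → count ls ps ≤ n ^ sum ls
count≤ {ls} pos ps {n} le = ≤-trans (exact pos ps) (^-monoˡ-≤ (sum ls) le)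
  where
  exact : ∀ {ls} → All (1 ≤_) ls → ∀ ps → count ls ps ≤ sum ps ^ sum ls
  exact []                         ps       = ≤-refl
  exact (_ ∷ _)                    []       = z≤n
  exact {suc l ∷ ls} (1≤l ∷ pos)   (p ∷ ps) = begin
    (p C suc l) * count ls ps + count (suc l ∷ ls) ps
      ≤⟨ +-mono-≤ (*-mono-≤ (C≤^ p (suc l)) (exact pos ps)) (exact (1≤l ∷ pos) ps) ⟩
    p ^ suc l * s ^ sum ls + s ^ (suc l + sum ls)
      ≡⟨ cong (p ^ suc l * s ^ sum ls +_) (^-distribˡ-+-* s (suc l) (sum ls)) ⟩
    p ^ suc l * s ^ sum ls + s ^ suc l * s ^ sum ls
      ≡⟨ sym (*-distribʳ-+ (s ^ sum ls) (p ^ suc l) (s ^ suc l)) ⟩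
    (p ^ suc l + s ^ suc l) * s ^ sum ls
      ≤⟨ *-mono-≤ (^-super p s l) (^-monoˡ-≤ (sum ls) (m≤n+m s p)) ⟩
    (p + s) ^ suc l * (p + s) ^ sum ls
      ≡⟨ sym (^-distribˡ-+-* (p + s) (suc l) (sum ls)) ⟩
    (p + s) ^ (suc l + sum ls) ∎
    where s = sum ps

-- Bounds what is lost by no longer hosting the last pattern layer in `ps`; with `u ++ [ a ]` it
-- frees a layer of size a for the merged block.
count-snoc≤ : ∀ u l ps → count (u ++ [ suc l ]) ps ≤ count u ps * sum ps ^ suc l
count-snoc≤ u l ps = go u ps
  where
  go : ∀ u ps → count (u ++ [ suc l ]) ps ≤ count u ps * sum ps ^ suc l
  go []      []       = z≤n
  go []      (p ∷ ps) = begin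
    (p C suc l) * 1 + count [ suc l ] ps     ≤⟨ +-mono-≤ (≤-trans (≤-reflexive (*-identityʳ _)) (C≤^ p (suc l))) (≤-trans (go [] ps) (≤-reflexive (*-identityˡ _))) ⟩
    p ^ suc l + sum ps ^ suc l               ≤⟨ ^-super p (sum ps) l ⟩
    (p + sum ps) ^ suc l                     ≡⟨ sym (*-identityˡ _) ⟩
    1 * (p + sum ps) ^ suc l                 ∎
  go (b ∷ u) []       = z≤n
  go (b ∷ u) (p ∷ ps) = begin
    (p C b) * count (u ++ [ suc l ]) ps + count (b ∷ u ++ [ suc l ]) ps
      ≤⟨ +-mono-≤ (*-monoʳ-≤ (p C b) (go u ps)) (go (b ∷ u) ps) ⟩
    (p C b) * (count u ps * s) + count (b ∷ u) ps * s
      ≡⟨ dist (p C b) (count u ps) s (count (b ∷ u) ps) ⟩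
    ((p C b) * count u ps + count (b ∷ u) ps) * s
      ≤⟨ *-monoʳ-≤ (count (b ∷ u) (p ∷ ps)) (^-monoˡ-≤ (suc l) (m≤n+m (sum ps) p)) ⟩
    count (b ∷ u) (p ∷ ps) * (p + sum ps) ^ suc l ∎
    where
    s = sum ps ^ suc l
    dist : ∀ c x y z → c * (x * y) + z * y ≡ (c * x + z) * y
    dist = solve-∀

count-mono-layer : ∀ ls pre {z z'} zs → z ≤ z' → count ls (pre ++ z ∷ zs) ≤ count ls (pre ++ z' ∷ zs)
count-mono-layer []       pre       zs le = ≤-refl
count-mono-layer (l ∷ ls) []        zs le = +-monoˡ-≤ (count (l ∷ ls) zs) (*-monoˡ-≤ (count ls zs) (C-monoˡ l le))
count-mono-layer (l ∷ ls) (p ∷ pre) zs le =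
  +-mono-≤ (*-monoʳ-≤ (p C l) (count-mono-layer ls pre zs le)) (count-mono-layer (l ∷ ls) pre zs le)

-- Enlarging z to z + x gains at least the new occurrences whose first pattern layer lies in that
-- layer; other occurrences do not decrease. Both differences are moved across to avoid subtraction.
count-enlarge : ∀ l ls pre z x zs →
  count (l ∷ ls) (pre ++ z ∷ zs) + ((z + x) C l) * count ls zs
    ≤ count (l ∷ ls) (pre ++ (z + x) ∷ zs) + (z C l) * count ls zs
count-enlarge l ls []        z x zs =
  ≤-reflexive (swap ((z C l) * count ls zs) (count (l ∷ ls) zs) (((z + x) C l) * count ls zs))
  where
  swap : ∀ a b c → a + b + c ≡ c + b + a
  swap = solve-∀
count-enlarge l ls (p ∷ pre) z x zs = begin
  (p C l) * c₁ + d₁ + e₁      ≡⟨ +-assoc ((p C l) * c₁) d₁ e₁ ⟩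
  (p C l) * c₁ + (d₁ + e₁)    ≤⟨ +-mono-≤ (*-monoʳ-≤ (p C l) (count-mono-layer ls pre zs (m≤m+n z x)))
                                          (count-enlarge l ls pre z x zs) ⟩
  (p C l) * c₂ + (d₂ + e₂)    ≡⟨ sym (+-assoc ((p C l) * c₂) d₂ e₂) ⟩
  (p C l) * c₂ + d₂ + e₂      ∎
  where
  c₁ = count ls (pre ++ z ∷ zs)
  c₂ = count ls (pre ++ (z + x) ∷ zs)
  d₁ = count (l ∷ ls) (pre ++ z ∷ zs)
  d₂ = count (l ∷ ls) (pre ++ (z + x) ∷ zs)
  e₁ = ((z + x) C l) * count ls zs
  e₂ = (z C l) * count ls zs

-- Optimality tested against layered competitors, in terms of layer sizes; `optimal⇒maximal` derives
-- it from optimality among all permutations.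
Maximal : List ℕ → List ℕ → Set
Maximal ls p = ∀ q → All (1 ≤_) q → sum q ≡ sum p → count ls q ≤ count ls p

-- Adding x points to the layer z multiplies the occurrences in which z is used as
-- the first layer of the pattern by at least (z + x) / z; average over z.
growth : ∀ l ls pre post x U →
  (∀ pre' z zs → pre ++ post ≡ pre' ++ z ∷ zs → count (suc l ∷ ls) (pre' ++ (z + x) ∷ zs) ≤ U) →
  sum post * count (suc l ∷ ls) (pre ++ post) + x * count (suc l ∷ ls) post ≤ sum post * U
growth l ls pre []       x U H = ≤-reflexive (*-zeroʳ x)
growth l ls pre (z ∷ zs) x U H = begin
  (z + sum zs) * F + x * (c * count ls zs + count (suc l ∷ ls) zs)
    ≡⟨ rearr z (sum zs) F x (c * count ls zs) (count (suc l ∷ ls) zs) ⟩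
  (z * F + x * (c * count ls zs)) + (sum zs * F + x * count (suc l ∷ ls) zs)
    ≤⟨ +-mono-≤ first-term rest ⟩
  z * U + sum zs * U
    ≡⟨ sym (*-distribʳ-+ U z (sum zs)) ⟩
  (z + sum zs) * U ∎
  where
  F = count (suc l ∷ ls) (pre ++ z ∷ zs)
  c = z C suc l
  rearr : ∀ z s F x a b → (z + s) * F + x * (a + b) ≡ (z * F + x * a) + (s * F + x * b)
  rearr = solve-∀
  assoc : (pre ++ [ z ]) ++ zs ≡ pre ++ z ∷ zs
  assoc = ++-assoc pre [ z ] zs
  rest : sum zs * F + x * count (suc l ∷ ls) zs ≤ sum zs * U
  rest = subst (λ q → sum zs * count (suc l ∷ ls) q + x * count (suc l ∷ ls) zs ≤ sum zs * U) assoc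
    (growth l ls (pre ++ [ z ]) zs x U (λ pre' z' zs' eq → H pre' z' zs' (trans (sym assoc) eq)))
  first-term : z * F + x * (c * count ls zs) ≤ z * U
  first-term = +-cancelʳ-≤ (z * (c * count ls zs)) _ _ (begin
    z * F + x * (c * count ls zs) + z * (c * count ls zs)
      ≡⟨ rearr₁ z F x c (count ls zs) ⟩
    z * F + ((z + x) * c) * count ls zs
      ≤⟨ +-monoʳ-≤ (z * F) (*-monoˡ-≤ (count ls zs) (C-ratio z x l)) ⟩
    z * F + (z * ((z + x) C suc l)) * count ls zs
      ≡⟨ rearr₂ z F ((z + x) C suc l) (count ls zs) ⟩
    z * (F + ((z + x) C suc l) * count ls zs)
      ≤⟨ *-monoʳ-≤ z (count-enlarge (suc l) ls pre z x zs) ⟩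
    z * (count (suc l ∷ ls) (pre ++ (z + x) ∷ zs) + c * count ls zs)
      ≤⟨ *-monoʳ-≤ z (+-monoˡ-≤ (c * count ls zs) (H pre z zs refl)) ⟩
    z * (U + c * count ls zs)
      ≡⟨ *-distribˡ-+ z U (c * count ls zs) ⟩
    z * U + z * (c * count ls zs) ∎)
    where
    rearr₁ : ∀ z F x c d → z * F + x * (c * d) + z * (c * d) ≡ z * F + ((z + x) * c) * d
    rearr₁ = solve-∀
    rearr₂ : ∀ z F e d → z * F + (z * e) * d ≡ z * (F + e * d)
    rearr₂ = solve-∀

startingAt : ℕ → List ℕ → List ℕ → ℕ
startingAt x B []      = 0
startingAt x B (l ∷ v) = (x C l) * count v B

-- The occurrences that use the layer x: for a split u, v of the pattern, u is hosted in A and x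
-- hosts the first layer of v.
through : List ℕ → List ℕ → ℕ → List ℕ → ℕ
through ls A x B = sumSplits (λ u v → count u A * startingAt x B v) ls

count-∷ : ∀ ls x B → count ls (x ∷ B) ≡ startingAt x B ls + count ls B
count-∷ []       x B = refl
count-∷ (l ∷ ls) x B = refl

count-insert : ∀ ls A x B → count ls (A ++ x ∷ B) ≡ through ls A x B + count ls (A ++ B)
count-insert ls A x B = begin-equality
  count ls (A ++ x ∷ B)
    ≡⟨ count-++ ls A (x ∷ B) ⟩
  sumSplits (λ u v → count u A * count v (x ∷ B)) ls
    ≡⟨ sumSplits-cong (λ u v → trans (cong (count u A *_) (count-∷ v x B))
         (*-distribˡ-+ (count u A) (startingAt x B v) (count v B))) ls ⟩
  sumSplits (λ u v → count u A * startingAt x B v + count u A * count v B) ls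
    ≡⟨ sumSplits-+ (λ u v → count u A * startingAt x B v) (λ u v → count u A * count v B) ls ⟩
  through ls A x B + sumSplits (λ u v → count u A * count v B) ls
    ≡⟨ cong (through ls A x B +_) (sym (count-++ ls A B)) ⟩
  through ls A x B + count ls (A ++ B) ∎

sum-middle : ∀ A x B → sum (A ++ x ∷ B) ≡ sum (A ++ B) + x
sum-middle []      x B = +-comm x (sum B)
sum-middle (a ∷ A) x B = trans (cong (a +_) (sum-middle A x B)) (sym (+-assoc a _ x))

-- Delete the layer x and give its points to another layer. By maximality no list obtained this way
-- has more than F occurrences, and `growth` averages these comparisons to x F₀ ≤ n' D, where D
-- counts the occurrences lost by the deletion.
layer-share : ∀ l ls A x B → All (1 ≤_) (A ++ B) → Maximal (suc l ∷ ls) (A ++ x ∷ B) →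
  x * count (suc l ∷ ls) (A ++ x ∷ B) ≤ sum (A ++ x ∷ B) * through (suc l ∷ ls) A x B
layer-share l ls A x B pos max = begin
  x * F                        ≡⟨ cong (x *_) insert ⟩
  x * (D + F₀)                 ≡⟨ trans (*-distribˡ-+ x D F₀) (+-comm (x * D) (x * F₀)) ⟩
  x * F₀ + x * D               ≤⟨ +-monoˡ-≤ (x * D) gain ⟩
  n' * D + x * D               ≡⟨ sym (*-distribʳ-+ D n' x) ⟩
  (n' + x) * D                 ≡⟨ cong (_* D) (sym (sum-middle A x B)) ⟩
  sum (A ++ x ∷ B) * D         ∎
  where
  F  = count (suc l ∷ ls) (A ++ x ∷ B)
  F₀ = count (suc l ∷ ls) (A ++ B)
  D  = through (suc l ∷ ls) A x B
  n' = sum (A ++ B)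
  insert : F ≡ D + F₀
  insert = count-insert (suc l ∷ ls) A x B
  enlarge-pos : ∀ pre' z zs → All (1 ≤_) (pre' ++ z ∷ zs) → All (1 ≤_) (pre' ++ (z + x) ∷ zs)
  enlarge-pos []         z zs (p ∷ ps) = ≤-trans p (m≤m+n z x) ∷ ps
  enlarge-pos (_ ∷ pre') z zs (p ∷ ps) = p ∷ enlarge-pos pre' z zs ps
  bounded : ∀ pre' z zs → A ++ B ≡ pre' ++ z ∷ zs → count (suc l ∷ ls) (pre' ++ (z + x) ∷ zs) ≤ F
  bounded pre' z zs eq = max _ (enlarge-pos pre' z zs (subst (All (1 ≤_)) eq pos)) (begin-equality
    sum (pre' ++ (z + x) ∷ zs)    ≡⟨ sum-middle pre' (z + x) zs ⟩
    sum (pre' ++ zs) + (z + x)    ≡⟨ sym (+-assoc _ z x) ⟩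
    sum (pre' ++ zs) + z + x      ≡⟨ cong (_+ x) (sym (sum-middle pre' z zs)) ⟩
    sum (pre' ++ z ∷ zs) + x      ≡⟨ cong (λ q → sum q + x) (sym eq) ⟩
    n' + x                        ≡⟨ sym (sum-middle A x B) ⟩
    sum (A ++ x ∷ B)              ∎)
  gain : x * F₀ ≤ n' * D
  gain = +-cancelˡ-≤ (n' * F₀) _ _ (begin
    n' * F₀ + x * F₀     ≤⟨ growth l ls [] (A ++ B) x F bounded ⟩
    n' * F               ≡⟨ cong (n' *_) insert ⟩
    n' * (D + F₀)        ≡⟨ trans (*-distribˡ-+ n' D F₀) (+-comm (n' * D) (n' * F₀)) ⟩
    n' * F₀ + n' * D     ∎)

-- Merging layers

*-^ : ∀ x y k → (x * y) ^ k ≡ x ^ k * y ^ k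
*-^ x y zero    = refl
*-^ x y (suc k) = trans (cong (x * y *_) (*-^ x y k)) (swap x y (x ^ k) (y ^ k))
  where
  swap : ∀ a b c d → a * b * (c * d) ≡ a * c * (b * d)
  swap = solve-∀

sum-scaled : ∀ ls t → sum (map (_* t) ls) ≡ sum ls * t
sum-scaled []       t = refl
sum-scaled (l ∷ ls) t = trans (cong (l * t +_) (sum-scaled ls t)) (sym (*-distribʳ-+ t l (sum ls)))

-- It suffices to count the embeddings that put each pattern layer into its own scaled copy.
count-scaled : ∀ ls t → t ^ sum ls ≤ count ls (map (_* t) ls)
count-scaled []       t = ≤-refl
count-scaled (l ∷ ls) t = begin
  t ^ (l + sum ls)                                        ≡⟨ ^-distribˡ-+-* t l (sum ls) ⟩
  t ^ l * t ^ sum ls                                      ≤⟨ *-mono-≤ (^≤C t l) (count-scaled ls t) ⟩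
  ((l * t) C l) * count ls (map (_* t) ls)                ≤⟨ m≤m+n _ _ ⟩
  count (l ∷ ls) (l * t ∷ map (_* t) ls)                  ∎

scaled-positive : ∀ {ls t} → All (1 ≤_) ls → 1 ≤ t → All (1 ≤_) (map (_* t) ls)
scaled-positive []           1≤t = []
scaled-positive (1≤l ∷ pos)  1≤t = *-mono-≤ 1≤l 1≤t ∷ scaled-positive pos 1≤t

-- The competitor has layer sizes t * lᵢ, where t = n / sum ls, with the remainder
-- of the division added to its first layer.
maximal-lower : ∀ l ls p → All (1 ≤_) (suc l ∷ ls) → Maximal (suc l ∷ ls) p →
  sum (suc l ∷ ls) ≤ sum p →
  sum p ^ sum (suc l ∷ ls) ≤ (2 * sum (suc l ∷ ls)) ^ sum (suc l ∷ ls) * count (suc l ∷ ls) p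
maximal-lower l ls p pos@(_ ∷ pos′) max m≤n = begin
  n ^ m                                  ≤⟨ ^-monoˡ-≤ m n≤2mt ⟩
  (2 * m * t) ^ m                        ≡⟨ *-^ (2 * m) t m ⟩
  (2 * m) ^ m * t ^ m                    ≤⟨ *-monoʳ-≤ ((2 * m) ^ m) (begin
    t ^ m                                  ≤⟨ count-scaled (suc l ∷ ls) t ⟩
    count (suc l ∷ ls) (suc l * t ∷ rest)  ≤⟨ count-mono-layer (suc l ∷ ls) [] rest (m≤m+n (suc l * t) r) ⟩
    count (suc l ∷ ls) q                   ≤⟨ max q q-pos q-sum ⟩
    count (suc l ∷ ls) p                   ∎) ⟩
  (2 * m) ^ m * count (suc l ∷ ls) p     ∎
  where
  m = sum (suc l ∷ ls)
  n = sum p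
  t = n / m
  r = n % m
  rest = map (_* t) ls
  q = suc l * t + r ∷ rest
  1≤t : 1 ≤ t
  1≤t = m≥n⇒m/n>0 m≤n
  q-pos : All (1 ≤_) q
  q-pos = ≤-trans (*-mono-≤ {1} {suc l} (s≤s z≤n) 1≤t) (m≤m+n (suc l * t) r) ∷ scaled-positive pos′ 1≤t
  q-sum : sum q ≡ n
  q-sum = begin-equality
    suc l * t + r + sum rest        ≡⟨ cong (suc l * t + r +_) (sum-scaled ls t) ⟩
    suc l * t + r + sum ls * t      ≡⟨ rearr (suc l) t r (sum ls) ⟩
    r + t * m                       ≡⟨ sym (m≡m%n+[m/n]*n n m) ⟩
    n                               ∎
    where
    rearr : ∀ l t r s → l * t + r + s * t ≡ r + t * (l + s)
    rearr = solve-∀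
  n≤2mt : n ≤ 2 * m * t
  n≤2mt = begin
    n                  ≡⟨ m≡m%n+[m/n]*n n m ⟩
    r + t * m          ≤⟨ +-monoˡ-≤ (t * m) (≤-trans (<⇒≤ (m%n<n n m)) (≤-trans (≤-reflexive (sym (*-identityˡ m))) (*-monoˡ-≤ m 1≤t))) ⟩
    t * m + t * m      ≡⟨ rearr t m ⟩
    2 * m * t          ∎
    where
    rearr : ∀ t m → t * m + t * m ≡ 2 * m * t
    rearr = solve-∀

-- The lightest of the first `suc t` consecutive windows of length b has at most the average weight.
-- The induction compares the first window with the one found in the remainder.
light-chunk : ∀ t b q → suc t * b ≤ length q →
  ∃[ A ] ∃[ X ] ∃[ B ] (q ≡ A ++ X ++ B × length X ≡ b × suc t * sum X ≤ sum q)
light-chunk zero    b q le =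
  [] , take b q , drop b q , sym (take++drop≡id b q) ,
  trans (length-take b q) (m≤n⇒m⊓n≡m (≤-trans (m≤m+n b 0) le)) ,
  ≤-trans (≤-reflexive (+-identityʳ _))
    (≤-trans (m≤m+n _ (sum (drop b q)))
      (≤-reflexive (trans (sym (sum-++ (take b q) (drop b q))) (cong sum (take++drop≡id b q)))))
light-chunk (suc t) b q le
  with light-chunk t b (drop b q) (≤-trans (≤-reflexive (sym (m+n∸m≡n b (suc t * b))))
         (≤-trans (∸-monoˡ-≤ b le) (≤-reflexive (sym (length-drop b q)))))
... | A , X , B , eq , len , bound with ≤-total (sum (take b q)) (sum X)
...   | inj₁ light = [] , take b q , drop b q , sym (take++drop≡id b q) ,
        trans (length-take b q) (m≤n⇒m⊓n≡m (≤-trans (m≤m+n b _) le)) ,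
        (begin
          sum (take b q) + suc t * sum (take b q)
            ≤⟨ +-monoʳ-≤ (sum (take b q)) (≤-trans (*-monoʳ-≤ (suc t) light) bound) ⟩
          sum (take b q) + sum (drop b q)   ≡⟨ sym (sum-++ (take b q) (drop b q)) ⟩
          sum (take b q ++ drop b q)        ≡⟨ cong sum (take++drop≡id b q) ⟩
          sum q                             ∎)
...   | inj₂ heavy = take b q ++ A , X , B ,
        trans (sym (take++drop≡id b q)) (trans (cong (take b q ++_) eq) (sym (++-assoc (take b q) A (X ++ B)))) ,
        len ,
        (begin
          sum X + suc t * sum X             ≤⟨ +-mono-≤ heavy bound ⟩
          sum (take b q) + sum (drop b q)   ≡⟨ sym (sum-++ (take b q) (drop b q)) ⟩
          sum (take b q ++ drop b q)        ≡⟨ cong sum (take++drop≡id b q) ⟩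
          sum q                             ∎)

sumSplits-mono : ∀ φ ψ ls → (∀ u v → ls ≡ u ++ v → φ u v ≤ ψ u v) → sumSplits φ ls ≤ sumSplits ψ ls
sumSplits-mono φ ψ []       le = le [] [] refl
sumSplits-mono φ ψ (l ∷ ls) le = +-mono-≤ (le [] (l ∷ ls) refl)
  (sumSplits-mono (λ u → φ (l ∷ u)) (λ u → ψ (l ∷ u)) ls (λ u v eq → le (l ∷ u) v (cong (l ∷_) eq)))

Linked-++⁻ʳ : ∀ {R : ℕ → ℕ → Set} u {v} → Linked R (u ++ v) → Linked R v
Linked-++⁻ʳ []          lk       = lk
Linked-++⁻ʳ (_ ∷ [])    {[]}     lk = []
Linked-++⁻ʳ (_ ∷ [])    {_ ∷ _}  (_ ∷ lk) = lk
Linked-++⁻ʳ (_ ∷ y ∷ u) (_ ∷ lk) = Linked-++⁻ʳ (y ∷ u) lk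

-- The number of l-subsets of the merged layer that meet both parts. The truncated subtraction is
-- exact for l ≥ 1, by `C-super`.
surplus : ℕ → ℕ → ℕ → ℕ
surplus l x y = (x + y) C l ∸ (x C l + y C l)

surplus-eq : ∀ {l} x y → 1 ≤ l → x C l + y C l + surplus l x y ≡ (x + y) C l
surplus-eq {suc l} x y _ = m+[n∸m]≡n (C-super x y l)

C≤surplusˡ : ∀ x y k → y * (x C suc k) ≤ surplus (2 + k) x y
C≤surplusˡ x y k = m+n≤o⇒n≤o∸m (x C (2 + k) + y C (2 + k)) (C-super-lower x y k)
  where
  m+n≤o⇒n≤o∸m : ∀ m {n o} → m + n ≤ o → n ≤ o ∸ m
  m+n≤o⇒n≤o∸m m {n} le = subst (_≤ _ ∸ m) (m+n∸m≡n m n) (∸-monoˡ-≤ m le)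

surplus-comm : ∀ l x y → surplus l x y ≡ surplus l y x
surplus-comm l x y = cong₂ _∸_ (cong (_C l) (+-comm x y)) (+-comm (x C l) (y C l))

surplus-positive : ∀ x y k → 1 ≤ x → 1 ≤ y → 2 + k ≤ x + y → 1 ≤ surplus (2 + k) x y
surplus-positive x y k 1≤x 1≤y le = m<n⇒0<n∸m (C-super-strict x y k 1≤x 1≤y le)

C≤share : ∀ {n} y l → y ≤ n → 1 ≤ l → n * (y C l) ≤ y * n ^ l
C≤share {n} y (suc l) y≤n _ = begin
  n * (y C suc l)     ≤⟨ *-monoʳ-≤ n (C≤^ y (suc l)) ⟩
  n * (y * y ^ l)     ≤⟨ *-monoʳ-≤ n (*-monoʳ-≤ y (^-monoˡ-≤ l y≤n)) ⟩
  n * (y * n ^ l)     ≡⟨ swap n y (n ^ l) ⟩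
  y * (n * n ^ l)     ∎
  where
  swap : ∀ a b c → a * (b * c) ≡ b * (a * c)
  swap = solve-∀

-- C (x, a) ≤ x C (x, a - 1) and y C (x, a - 1) is part of the surplus.
pair-cost : ∀ {n} k x y l → y ≤ n → 1 ≤ l →
  n * ((x C (2 + k)) * (y C l)) ≤ n ^ l * (x * surplus (2 + k) x y)
pair-cost {n} k x y l y≤n 1≤l = begin
  n * ((x C (2 + k)) * (y C l))        ≡⟨ rearr₁ n (x C (2 + k)) (y C l) ⟩
  (x C (2 + k)) * (n * (y C l))        ≤⟨ *-mono-≤ (C-suc≤ x (suc k)) (C≤share y l y≤n 1≤l) ⟩
  x * (x C suc k) * (y * n ^ l)        ≡⟨ rearr₂ x (x C suc k) y (n ^ l) ⟩
  n ^ l * (x * (y * (x C suc k)))      ≤⟨ *-monoʳ-≤ (n ^ l) (*-monoʳ-≤ x (C≤surplusˡ x y k)) ⟩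
  n ^ l * (x * surplus (2 + k) x y)    ∎
  where
  rearr₁ : ∀ a b c → a * (b * c) ≡ b * (a * c)
  rearr₁ = solve-∀
  rearr₂ : ∀ x c y p → x * c * (y * p) ≡ p * (x * (y * c))
  rearr₂ = solve-∀

module Merging (j : ℕ) (ls : List ℕ) (pos : All (1 ≤_) ls)
               (adj : Linked (λ l l′ → l ≡ 2 + j ⊎ l′ ≡ 2 + j) ls) where

  a : ℕ
  a = 2 + j

  -- The effect of merging x and y on the occurrences of v that start there. Lost are those with the
  -- first two layers of v in x and in y; gained are those whose first layer meets both parts.
  loss gain : ℕ → ℕ → List ℕ → List ℕ → ℕ
  loss x y B []      = 0
  loss x y B (l ∷ v) = (x C l) * startingAt y B v
  gain x y B []      = 0
  gain x y B (l ∷ v) = surplus l x y * count v B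

  merge-local : ∀ x y B v → All (1 ≤_) v →
    count v (x ∷ y ∷ B) + gain x y B v ≡ count v (x + y ∷ B) + loss x y B v
  merge-local x y B []      _         = refl
  merge-local x y B (l ∷ v) (1≤l ∷ _) = begin-equality
    (x C l) * count v (y ∷ B) + ((y C l) * c + d) + surplus l x y * c
      ≡⟨ cong (λ t → (x C l) * t + ((y C l) * c + d) + surplus l x y * c) (count-∷ v y B) ⟩
    (x C l) * (startingAt y B v + c) + ((y C l) * c + d) + surplus l x y * c
      ≡⟨ rearr (x C l) (y C l) (surplus l x y) (startingAt y B v) c d ⟩
    (x C l + y C l + surplus l x y) * c + d + (x C l) * startingAt y B v
      ≡⟨ cong (λ t → t * c + d + (x C l) * startingAt y B v) (surplus-eq x y 1≤l) ⟩
    ((x + y) C l) * c + d + (x C l) * startingAt y B v ∎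
    where
    c = count v B
    d = count (l ∷ v) B
    rearr : ∀ p q s t c d → p * (t + c) + (q * c + d) + s * c ≡ (p + q + s) * c + d + p * t
    rearr = solve-∀

  -- One of the two pattern layers hosted by x and y has size a, so `pair-cost` expresses the loss
  -- through `surplus a x y`, the factor that also appears in the gain.
  loss-bound : ∀ {n} x y B v → All (1 ≤_) v → Linked (λ l l′ → l ≡ a ⊎ l′ ≡ a) v →
    x ≤ n → y ≤ n → sum B ≤ n →
    n ^ suc a * loss x y B v ≤ n ^ sum v * ((x + y) * surplus a x y)
  loss-bound {n} x y B []          _   _  _ _ _ = ≤-trans (≤-reflexive (*-zeroʳ (n ^ suc a))) z≤n
  loss-bound {n} x y B (l ∷ [])    _   _  _ _ _ =
    ≤-trans (≤-reflexive (trans (cong (n ^ suc a *_) (*-zeroʳ (x C l))) (*-zeroʳ (n ^ suc a)))) z≤n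
  loss-bound {n} x y B (l ∷ l′ ∷ v) (1≤l ∷ 1≤l′ ∷ pos) (some ∷ _) x≤n y≤n B≤n = begin
    n * n ^ a * ((x C l) * ((y C l′) * count v B))
      ≡⟨ rearr₁ n (n ^ a) (x C l) (y C l′) (count v B) ⟩
    n ^ a * (n * ((x C l) * (y C l′))) * count v B
      ≤⟨ *-mono-≤ (pair some) (count≤ pos B B≤n) ⟩
    n ^ l * n ^ l′ * ((x + y) * surplus a x y) * n ^ sum v
      ≡⟨ rearr₂ (n ^ l) (n ^ l′) ((x + y) * surplus a x y) (n ^ sum v) ⟩
    n ^ l * (n ^ l′ * n ^ sum v) * ((x + y) * surplus a x y)
      ≡⟨ cong (_* ((x + y) * surplus a x y)) (sym (trans (^-distribˡ-+-* n l (l′ + sum v)) (cong (n ^ l *_) (^-distribˡ-+-* n l′ (sum v))))) ⟩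
    n ^ (l + (l′ + sum v)) * ((x + y) * surplus a x y) ∎
    where
    rearr₁ : ∀ n p q r s → n * p * (q * (r * s)) ≡ p * (n * (q * r)) * s
    rearr₁ = solve-∀
    rearr₂ : ∀ p q w s → p * q * w * s ≡ p * (q * s) * w
    rearr₂ = solve-∀
    swap : ∀ p q w → p * (q * w) ≡ q * p * w
    swap = solve-∀
    pair : l ≡ a ⊎ l′ ≡ a →
      n ^ a * (n * ((x C l) * (y C l′))) ≤ n ^ l * n ^ l′ * ((x + y) * surplus a x y)
    pair (inj₁ refl) = begin
      n ^ a * (n * ((x C a) * (y C l′)))              ≤⟨ *-monoʳ-≤ (n ^ a) (pair-cost j x y l′ y≤n 1≤l′) ⟩
      n ^ a * (n ^ l′ * (x * surplus a x y))          ≤⟨ *-monoʳ-≤ (n ^ a) (*-monoʳ-≤ (n ^ l′) (*-monoˡ-≤ (surplus a x y) (m≤m+n x y))) ⟩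
      n ^ a * (n ^ l′ * ((x + y) * surplus a x y))    ≡⟨ sym (*-assoc (n ^ a) (n ^ l′) _) ⟩
      n ^ a * n ^ l′ * ((x + y) * surplus a x y)      ∎
    pair (inj₂ refl) = begin
      n ^ a * (n * ((x C l) * (y C a)))               ≡⟨ cong (λ t → n ^ a * (n * t)) (*-comm (x C l) (y C a)) ⟩
      n ^ a * (n * ((y C a) * (x C l)))               ≤⟨ *-monoʳ-≤ (n ^ a) (pair-cost j y x l x≤n 1≤l) ⟩
      n ^ a * (n ^ l * (y * surplus a y x))           ≡⟨ cong (λ t → n ^ a * (n ^ l * (y * t))) (surplus-comm a y x) ⟩
      n ^ a * (n ^ l * (y * surplus a x y))           ≤⟨ *-monoʳ-≤ (n ^ a) (*-monoʳ-≤ (n ^ l) (*-monoˡ-≤ (surplus a x y) (m≤n+m y x))) ⟩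
      n ^ a * (n ^ l * ((x + y) * surplus a x y))     ≡⟨ swap (n ^ a) (n ^ l) _ ⟩
      n ^ l * n ^ a * ((x + y) * surplus a x y)       ∎

  totalLoss totalGain : ℕ → ℕ → List ℕ → List ℕ → ℕ
  totalLoss x y A B = sumSplits (λ u v → count u A * loss x y B v) ls
  totalGain x y A B = sumSplits (λ u v → count u A * gain x y B v) ls

  merge-total : ∀ x y A B →
    count ls (A ++ x ∷ y ∷ B) + totalGain x y A B ≤ count ls (A ++ x + y ∷ B) + totalLoss x y A B
  merge-total x y A B = begin
    count ls (A ++ x ∷ y ∷ B) + totalGain x y A B
      ≡⟨ cong (_+ totalGain x y A B) (count-++ ls A (x ∷ y ∷ B)) ⟩
    sumSplits (λ u v → count u A * count v (x ∷ y ∷ B)) ls + totalGain x y A B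
      ≡⟨ sym (sumSplits-+ (λ u v → count u A * count v (x ∷ y ∷ B)) (λ u v → count u A * gain x y B v) ls) ⟩
    sumSplits (λ u v → count u A * count v (x ∷ y ∷ B) + count u A * gain x y B v) ls
      ≤⟨ sumSplits-mono _ _ ls pointwise ⟩
    sumSplits (λ u v → count u A * count v (x + y ∷ B) + count u A * loss x y B v) ls
      ≡⟨ sumSplits-+ (λ u v → count u A * count v (x + y ∷ B)) (λ u v → count u A * loss x y B v) ls ⟩
    sumSplits (λ u v → count u A * count v (x + y ∷ B)) ls + totalLoss x y A B
      ≡⟨ cong (_+ totalLoss x y A B) (sym (count-++ ls A (x + y ∷ B))) ⟩
    count ls (A ++ x + y ∷ B) + totalLoss x y A B ∎
    where
    pointwise : ∀ u v → ls ≡ u ++ v →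
      count u A * count v (x ∷ y ∷ B) + count u A * gain x y B v
        ≤ count u A * count v (x + y ∷ B) + count u A * loss x y B v
    pointwise u v refl = ≤-reflexive (trans (sym (*-distribˡ-+ (count u A) _ _))
      (trans (cong (count u A *_) (merge-local x y B v (++⁻ʳ u pos))) (*-distribˡ-+ (count u A) _ _)))

  totalLoss-bound : ∀ {n} x y A B → sum A ≤ n → x ≤ n → y ≤ n → sum B ≤ n →
    n ^ suc a * totalLoss x y A B ≤ suc (length ls) * (x + y) * n ^ sum ls * surplus a x y
  totalLoss-bound {n} x y A B A≤n x≤n y≤n B≤n
    with sumSplits-pigeonhole (λ u v → count u A * loss x y B v) ls
  ... | u , v , eq , le = begin
    n ^ suc a * totalLoss x y A B
      ≤⟨ *-monoʳ-≤ (n ^ suc a) le ⟩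
    n ^ suc a * (k₁ * (count u A * loss x y B v))
      ≡⟨ rearr₁ (n ^ suc a) k₁ (count u A) (loss x y B v) ⟩
    k₁ * (count u A * (n ^ suc a * loss x y B v))
      ≤⟨ *-monoʳ-≤ k₁ (*-mono-≤ (count≤ (++⁻ˡ u pos′) A A≤n)
           (loss-bound x y B v (++⁻ʳ u pos′) (Linked-++⁻ʳ u (subst (Linked _) eq adj)) x≤n y≤n B≤n)) ⟩
    k₁ * (n ^ sum u * (n ^ sum v * ((x + y) * surplus a x y)))
      ≡⟨ rearr₂ k₁ (n ^ sum u) (n ^ sum v) (x + y) (surplus a x y) ⟩
    k₁ * (x + y) * (n ^ sum u * n ^ sum v) * surplus a x y
      ≡⟨ cong (λ t → k₁ * (x + y) * t * surplus a x y)
           (trans (sym (^-distribˡ-+-* n (sum u) (sum v))) (cong (n ^_) (sym (trans (cong sum eq) (sum-++ u v))))) ⟩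
    k₁ * (x + y) * n ^ sum ls * surplus a x y ∎
    where
    k₁ = suc (length ls)
    pos′ : All (1 ≤_) (u ++ v)
    pos′ = subst (All (1 ≤_)) eq pos
    rearr₁ : ∀ p k c l → p * (k * (c * l)) ≡ k * (c * (p * l))
    rearr₁ = solve-∀
    rearr₂ : ∀ k p q x s → k * (p * (q * (x * s))) ≡ k * x * (p * q) * s
    rearr₂ = solve-∀

  module _ (U V : List ℕ) (ls≡ : ls ≡ U ++ a ∷ V) (n : ℕ) where

    totalGain-lower : ∀ x y A B → count U A * count V B * surplus a x y ≤ totalGain x y A B
    totalGain-lower x y A B = subst₂ _≤_
      (rearr (count U A) (surplus a x y) (count V B))
      (cong (sumSplits (λ u v → count u A * gain x y B v)) (sym ls≡))
      (term≤sumSplits (λ u v → count u A * gain x y B v) U (a ∷ V))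
      where
      rearr : ∀ p s q → p * (s * q) ≡ p * q * s
      rearr = solve-∀

    -- The comparison of `totalLoss-bound` with `totalGain-lower` after cancelling `surplus a x y`.
    -- It depends on the merged layers only through their total w, and it passes to partial merges
    -- of a block: w shrinks and the rest of the block adds hosts on the right.
    Favourable : ℕ → List ℕ → List ℕ → Set
    Favourable w A B = suc (length ls) * w * n ^ sum ls < n ^ suc a * (count U A * count V B)

    totalLoss≤totalGain : ∀ x y A B → sum A ≤ n → 1 ≤ x → x ≤ n → y ≤ n → sum B ≤ n →
      Favourable (x + y) A B → totalLoss x y A B ≤ totalGain x y A B
    totalLoss≤totalGain x y A B A≤n 1≤x x≤n y≤n B≤n fav =
      *-cancelˡ-≤ (n ^ suc a) {{m^n≢0 n (suc a) {{>-nonZero (≤-trans 1≤x x≤n)}}}} (begin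
      n ^ suc a * totalLoss x y A B
        ≤⟨ totalLoss-bound x y A B A≤n x≤n y≤n B≤n ⟩
      suc (length ls) * (x + y) * n ^ sum ls * surplus a x y
        ≤⟨ *-monoˡ-≤ (surplus a x y) (<⇒≤ fav) ⟩
      n ^ suc a * (count U A * count V B) * surplus a x y
        ≡⟨ *-assoc (n ^ suc a) _ _ ⟩
      n ^ suc a * (count U A * count V B * surplus a x y)
        ≤⟨ *-monoʳ-≤ (n ^ suc a) (totalGain-lower x y A B) ⟩
      n ^ suc a * totalGain x y A B ∎)

    totalLoss<totalGain : ∀ x y A B → sum A ≤ n → 1 ≤ x → x ≤ n → 1 ≤ y → y ≤ n → sum B ≤ n →
      a ≤ x + y → Favourable (x + y) A B → totalLoss x y A B < totalGain x y A B
    totalLoss<totalGain x y A B A≤n 1≤x x≤n 1≤y y≤n B≤n a≤ fav =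
      *-cancelˡ-< (n ^ suc a) _ _ (begin-strict
      n ^ suc a * totalLoss x y A B
        ≤⟨ totalLoss-bound x y A B A≤n x≤n y≤n B≤n ⟩
      suc (length ls) * (x + y) * n ^ sum ls * surplus a x y
        <⟨ *-monoˡ-< (surplus a x y) {{>-nonZero (surplus-positive x y j 1≤x 1≤y a≤)}} fav ⟩
      n ^ suc a * (count U A * count V B) * surplus a x y
        ≡⟨ *-assoc (n ^ suc a) _ _ ⟩
      n ^ suc a * (count U A * count V B * surplus a x y)
        ≤⟨ *-monoʳ-≤ (n ^ suc a) (totalGain-lower x y A B) ⟩
      n ^ suc a * totalGain x y A B ∎)

    -- Merges from the left, z being the layer accumulated so far. While the accumulated size is
    -- below a the surplus is zero, so intermediate merges are only known not to lose; the last one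
    -- reaches size at least a and is strict.
    merge-block : ∀ z x X A B → 1 ≤ z → All (1 ≤_) (x ∷ X) → sum A ≤ n → sum (z ∷ x ∷ X ++ B) ≤ n →
      a ≤ sum (z ∷ x ∷ X) → Favourable (sum (z ∷ x ∷ X)) A B →
      count ls (A ++ z ∷ x ∷ X ++ B) < count ls (A ++ sum (z ∷ x ∷ X) ∷ B)
    merge-block z x [] A B 1≤z (1≤x ∷ _) A≤n tot a≤ fav rewrite +-identityʳ x =
      +-cancelʳ-< (totalGain z x A B) _ _ (begin-strict
        count ls (A ++ z ∷ x ∷ B) + totalGain z x A B    ≤⟨ merge-total z x A B ⟩
        count ls (A ++ z + x ∷ B) + totalLoss z x A B    <⟨ +-monoʳ-< (count ls (A ++ z + x ∷ B)) less ⟩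
        count ls (A ++ z + x ∷ B) + totalGain z x A B    ∎)
      where
      less = totalLoss<totalGain z x A B A≤n 1≤z (≤-trans (m≤m+n z _) tot) 1≤x
        (≤-trans (m≤m+n x (sum B)) (≤-trans (m≤n+m _ z) tot))
        (≤-trans (m≤n+m (sum B) x) (≤-trans (m≤n+m _ z) tot)) a≤ fav
    merge-block z x (x′ ∷ X) A B 1≤z (1≤x ∷ pos) A≤n tot a≤ fav = begin-strict
      count ls (A ++ z ∷ x ∷ R)               ≤⟨ first ⟩
      count ls (A ++ z + x ∷ x′ ∷ X ++ B)     <⟨ merge-block (z + x) x′ X A B (≤-trans 1≤z (m≤m+n z x)) pos A≤n
                                                   (subst (_≤ n) (sym (+-assoc z x _)) tot)
                                                   (subst (a ≤_) eq a≤) (subst (λ w → Favourable w A B) eq fav) ⟩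
      count ls (A ++ z + x + sum (x′ ∷ X) ∷ B) ≡⟨ cong (λ w → count ls (A ++ w ∷ B)) (sym eq) ⟩
      count ls (A ++ sum (z ∷ x ∷ x′ ∷ X) ∷ B) ∎
      where
      R = x′ ∷ X ++ B
      eq : sum (z ∷ x ∷ x′ ∷ X) ≡ sum (z + x ∷ x′ ∷ X)
      eq = sym (+-assoc z x (sum (x′ ∷ X)))
      fav′ : Favourable (z + x) A R
      fav′ = begin-strict
        suc (length ls) * (z + x) * n ^ sum ls
          ≤⟨ *-monoˡ-≤ (n ^ sum ls) (*-monoʳ-≤ (suc (length ls)) (subst (z + x ≤_) (sym eq) (m≤m+n (z + x) _))) ⟩
        suc (length ls) * sum (z ∷ x ∷ x′ ∷ X) * n ^ sum ls
          <⟨ fav ⟩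
        n ^ suc a * (count U A * count V B)
          ≤⟨ *-monoʳ-≤ (n ^ suc a) (*-monoʳ-≤ (count U A) (count-++ˡ V (x′ ∷ X) B)) ⟩
        n ^ suc a * (count U A * count V R) ∎
      first : count ls (A ++ z ∷ x ∷ R) ≤ count ls (A ++ z + x ∷ R)
      first = +-cancelʳ-≤ (totalGain z x A R) _ _ (begin
        count ls (A ++ z ∷ x ∷ R) + totalGain z x A R    ≤⟨ merge-total z x A R ⟩
        count ls (A ++ z + x ∷ R) + totalLoss z x A R    ≤⟨ +-monoʳ-≤ (count ls (A ++ z + x ∷ R))
          (totalLoss≤totalGain z x A R A≤n 1≤z (≤-trans (m≤m+n z _) tot)
            (≤-trans (m≤m+n x (sum R)) (≤-trans (m≤n+m _ z) tot))
            (≤-trans (m≤n+m (sum R) x) (≤-trans (m≤n+m _ z) tot)) fav′) ⟩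
        count ls (A ++ z + x ∷ R) + totalGain z x A R    ∎)

-- Light runs of layers

-- The mirror image of `count-snoc≤`, for freeing the layer of size a that follows a layer of size
-- one.
count-cons≤ : ∀ l w ps → count (suc l ∷ w) ps ≤ sum ps ^ suc l * count w ps
count-cons≤ l w []       = z≤n
count-cons≤ l w (p ∷ ps) = begin
  (p C suc l) * count w ps + count (suc l ∷ w) ps
    ≤⟨ +-mono-≤ (*-monoˡ-≤ (count w ps) (C≤^ p (suc l))) (count-cons≤ l w ps) ⟩
  p ^ suc l * count w ps + sum ps ^ suc l * count w ps
    ≡⟨ sym (*-distribʳ-+ (count w ps) (p ^ suc l) (sum ps ^ suc l)) ⟩
  (p ^ suc l + sum ps ^ suc l) * count w ps
    ≤⟨ *-mono-≤ (^-super p (sum ps) l) (count-++ˡ w [ p ] ps) ⟩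
  (p + sum ps) ^ suc l * count w (p ∷ ps) ∎

-- A pattern layer of size at least two leaves a second factor y to be traded for n / d. This is why
-- a light layer cannot earn its share by hosting such a layer.
C-small : ∀ d y n k → d * y ≤ n → y ≤ n → d * (y C (2 + k)) ≤ y * n ^ suc k
C-small d y n k dy≤n y≤n = begin
  d * (y C (2 + k))       ≤⟨ *-monoʳ-≤ d (C≤^ y (2 + k)) ⟩
  d * (y * (y * y ^ k))   ≡⟨ rearr d y (y ^ k) ⟩
  y * ((d * y) * y ^ k)   ≤⟨ *-monoʳ-≤ y (*-mono-≤ dy≤n (^-monoˡ-≤ k y≤n)) ⟩
  y * (n * n ^ k)         ∎
  where
  rearr : ∀ d y p → d * (y * (y * p)) ≡ y * ((d * y) * p)
  rearr = solve-∀

-- The error term bounds the embeddings whose first layer lies in G: by `C-small`, each layer y of G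
-- contributes at most a d-th of y n^(1+k) n^(sum w).
small-layers-negligible : ∀ d k {w} → All (1 ≤_) w → ∀ G B {n} → d * sum G ≤ n → sum (G ++ B) ≤ n →
  d * count (2 + k ∷ w) (G ++ B) ≤ d * count (2 + k ∷ w) B + sum G * (n ^ suc k * n ^ sum w)
small-layers-negligible d k {w} pos []      B dG≤n G≤n = m≤m+n _ _
small-layers-negligible d k {w} pos (y ∷ G) B {n} dG≤n G≤n = begin
  d * ((y C (2 + k)) * count w (G ++ B) + count (2 + k ∷ w) (G ++ B))
    ≡⟨ rearr₁ d (y C (2 + k)) (count w (G ++ B)) (count (2 + k ∷ w) (G ++ B)) ⟩
  d * (y C (2 + k)) * count w (G ++ B) + d * count (2 + k ∷ w) (G ++ B)
    ≤⟨ +-mono-≤ (*-mono-≤ (C-small d y n k (≤-trans (*-monoʳ-≤ d (m≤m+n y (sum G))) dG≤n) (≤-trans (m≤m+n y _) G≤n))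
                          (count≤ pos (G ++ B) rest≤n))
                (small-layers-negligible d k pos G B (≤-trans (*-monoʳ-≤ d (m≤n+m (sum G) y)) dG≤n) rest≤n) ⟩
  y * n ^ suc k * n ^ sum w + (d * count (2 + k ∷ w) B + sum G * (n ^ suc k * n ^ sum w))
    ≡⟨ rearr₂ y (n ^ suc k) (n ^ sum w) (d * count (2 + k ∷ w) B) (sum G) ⟩
  d * count (2 + k ∷ w) B + (y + sum G) * (n ^ suc k * n ^ sum w) ∎
  where
  rest≤n : sum (G ++ B) ≤ n
  rest≤n = ≤-trans (m≤n+m _ y) G≤n
  rearr₁ : ∀ d c x z → d * (c * x + z) ≡ d * c * x + d * z
  rearr₁ = solve-∀
  rearr₂ : ∀ y p q z s → y * p * q + (z + s * (p * q)) ≡ z + (y + s) * (p * q)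
  rearr₂ = solve-∀

length≤sum : ∀ {X} → All (1 ≤_) X → length X ≤ sum X
length≤sum []          = z≤n
length≤sum (1≤x ∷ pos) = +-mono-≤ 1≤x (length≤sum pos)

module Bounded (j : ℕ) (ls′ front : List ℕ) (ends : 2 + j ∷ ls′ ≡ front ++ [ 2 + j ])
               (pos : All (1 ≤_) (2 + j ∷ ls′))
               (adj : Linked (λ l l′ → l ≡ 2 + j ⊎ l′ ≡ 2 + j) (2 + j ∷ ls′)) where

  ls : List ℕ
  ls = 2 + j ∷ ls′

  open Merging j ls pos adj

  -- An optimum has at least n ^ m / c₀ occurrences. A run of layers is light if its total
  -- size is at most n / D, and a block of it is light compared with one side if M times
  -- its size is less than the size of that side.
  m c₀ k₁ E D M : ℕ
  m  = sum ls
  c₀ = (2 * m) ^ m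
  k₁ = suc (length ls)
  E  = c₀ * k₁
  D  = suc (E + E)
  M  = D * k₁

  -- The last pattern layer has size a ≥ 2, so a layer of size one has a successor, and by `adj` one
  -- of the two has size a.
  one-followed : ∀ u w → ls ≡ u ++ 1 ∷ w → ∃[ w′ ] w ≡ a ∷ w′
  one-followed u []       eq with () ← ∷ʳ-injectiveʳ u front (trans (sym eq) ends)
  one-followed u (l ∷ w)  eq with Linked-++⁻ʳ u (subst (Linked _) eq adj)
  ... | inj₂ refl ∷ _ = w , refl

  one-preceded : ∀ u w → ls ≡ u ++ 1 ∷ w → ∃[ u′ ] u ≡ u′ ++ [ a ]
  one-preceded u w eq with initLast u
  one-preceded .[] w ()            | []
  one-preceded .(u ++ [ l ]) w eq  | u ∷ʳ′ l
    with Linked-++⁻ʳ u (subst (Linked _) (trans eq (++-assoc u [ l ] (1 ∷ w))) adj)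
  ... | inj₁ refl ∷ _ = u , refl

  split-degree : ∀ n u l w → ls ≡ u ++ l ∷ w → n ^ m ≡ n ^ sum u * (n ^ l * n ^ sum w)
  split-degree n u l w eq = trans
    (cong (n ^_) (trans (cong sum eq) (sum-++ u (l ∷ w))))
    (trans (^-distribˡ-+-* n (sum u) (l + sum w)) (cong (n ^ sum u *_) (^-distribˡ-+-* n l (sum w))))

  -- Only the first layer g of the run is asked where its share of the occurrences comes from. Of
  -- the rest G, only the small total weight is used.
  module Run (A : List ℕ) (g : ℕ) (G B : List ℕ) (1≤g : 1 ≤ g) (n : ℕ)
             (sum≡ : sum (A ++ g ∷ G ++ B) ≡ n)
             (light : D * sum (g ∷ G) ≤ n)
             (lower : n ^ m ≤ c₀ * count ls (A ++ g ∷ G ++ B))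
             (share : g * count ls (A ++ g ∷ G ++ B) ≤ n * through ls A g (G ++ B)) where

    sum-split : sum A + (g + sum (G ++ B)) ≡ n
    sum-split = trans (sym (sum-++ A (g ∷ G ++ B))) sum≡

    A≤n : sum A ≤ n
    A≤n = subst (sum A ≤_) sum-split (m≤m+n (sum A) _)

    g+GB≤n : g + sum (G ++ B) ≤ n
    g+GB≤n = subst (g + sum (G ++ B) ≤_) sum-split (m≤n+m _ (sum A))

    GB≤n : sum (G ++ B) ≤ n
    GB≤n = ≤-trans (m≤n+m _ g) g+GB≤n

    g≤n : g ≤ n
    g≤n = ≤-trans (m≤m+n g _) g+GB≤n

    instance
      n≢0 : NonZero n
      n≢0 = >-nonZero (≤-trans 1≤g g≤n)

    D*g≤n : D * g ≤ n
    D*g≤n = ≤-trans (*-monoʳ-≤ D (m≤m+n g (sum G))) light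

    D*G≤n : D * sum G ≤ n
    D*G≤n = ≤-trans (*-monoʳ-≤ D (m≤n+m (sum G) g)) light

    -- By `lower` and `share` at least g n^(m-1) / c₀ occurrences use g, and one of the k₁ splits
    -- accounts for a k₁-th of them; hence E = c₀ k₁.
    heavy-split : ∃[ u ] ∃[ v ] (ls ≡ u ++ v ×
      g * n ^ m ≤ E * (n * (count u A * startingAt g (G ++ B) v)))
    heavy-split with sumSplits-pigeonhole (λ u v → count u A * startingAt g (G ++ B) v) ls
    ... | u , v , eq , le = u , v , eq , (begin
      g * n ^ m
        ≤⟨ *-monoʳ-≤ g lower ⟩
      g * (c₀ * count ls (A ++ g ∷ G ++ B))
        ≡⟨ rearr₁ g (c₀) _ ⟩
      c₀ * (g * count ls (A ++ g ∷ G ++ B))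
        ≤⟨ *-monoʳ-≤ (c₀) (≤-trans share (*-monoʳ-≤ n le)) ⟩
      c₀ * (n * (k₁ * (count u A * startingAt g (G ++ B) v)))
        ≡⟨ rearr₂ (c₀) n k₁ _ ⟩
      E * (n * (count u A * startingAt g (G ++ B) v)) ∎)
      where
      rearr₁ : ∀ x y z → x * (y * z) ≡ y * (x * z)
      rearr₁ = solve-∀
      rearr₂ : ∀ c n k t → c * (n * (k * t)) ≡ c * k * (n * t)
      rearr₂ = solve-∀

    g*n^m>0 : 1 ≤ g * n ^ m
    g*n^m>0 = *-mono-≤ 1≤g (m^n>0 n m)

    -- By `C-small` such a split could reach only a fraction E / D < 1 of what is required.
    not-big : ∀ u l w → ls ≡ u ++ 2 + l ∷ w →
      g * n ^ m ≤ E * (n * (count u A * ((g C (2 + l)) * count w (G ++ B)))) → ⊥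
    not-big u l w eq le = <⇒≱ (*-monoˡ-< (g * n ^ m) {{>-nonZero g*n^m>0}} (s≤s (m≤m+n E E))) (begin
      D * (g * n ^ m)
        ≤⟨ *-monoʳ-≤ D le ⟩
      D * (E * (n * (count u A * ((g C (2 + l)) * count w (G ++ B)))))
        ≡⟨ rearr₁ D E n (count u A) (g C (2 + l)) (count w (G ++ B)) ⟩
      E * (n * (count u A * (D * (g C (2 + l)) * count w (G ++ B))))
        ≤⟨ *-monoʳ-≤ E (*-monoʳ-≤ n (*-mono-≤ (count≤ (++⁻ˡ u pos′) A A≤n)
             (*-mono-≤ (C-small D g n l D*g≤n g≤n) (count≤ (tail (++⁻ʳ u pos′)) (G ++ B) GB≤n)))) ⟩
      E * (n * (n ^ sum u * (g * n ^ suc l * n ^ sum w)))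
        ≡⟨ rearr₂ E n (n ^ sum u) g (n ^ suc l) (n ^ sum w) ⟩
      E * (g * (n ^ sum u * (n ^ (2 + l) * n ^ sum w)))
        ≡⟨ cong (λ t → E * (g * t)) (sym (split-degree n u (2 + l) w eq)) ⟩
      E * (g * n ^ m) ∎)
      where
      pos′ = subst (All (1 ≤_)) eq pos
      tail : ∀ {l w} → All (1 ≤_) (l ∷ w) → All (1 ≤_) w
      tail (_ ∷ p) = p
      rearr₁ : ∀ d e n c x f → d * (e * (n * (c * (x * f)))) ≡ e * (n * (c * (d * x * f)))
      rearr₁ = solve-∀
      rearr₂ : ∀ e n c g x f → e * (n * (c * (g * x * f))) ≡ e * (g * (c * (n * x * f)))
      rearr₂ = solve-∀

    -- The factor g cancels because g hosts a single point. Embeddings of the rest that put the next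
    -- layer into G are negligible, so most of them lie outside the run, and the points of the run
    -- become free for the merged block and the layer of size one.
    abundant-from : ∀ u w → ls ≡ u ++ 1 ∷ a ∷ w →
      g * n ^ m ≤ E * (n * (count u A * ((g C 1) * count (a ∷ w) (G ++ B)))) →
      n ^ m ≤ D * (n * (count u A * count (a ∷ w) B))
    -- D = `suc E + E`: the summand E absorbs the error from G, and `suc E` is left to be cancelled.
    abundant-from u w eq le = *-cancelˡ-≤ (suc E) (+-cancelʳ-≤ (E * n ^ m) _ _ (begin
      suc E * n ^ m + E * n ^ m
        ≡⟨ sym (*-distribʳ-+ (n ^ m) (suc E) E) ⟩
      D * n ^ m
        ≤⟨ *-monoʳ-≤ D cancelled ⟩
      D * (E * (n * (cA * count (a ∷ w) (G ++ B))))
        ≡⟨ rearr₁ D E n cA (count (a ∷ w) (G ++ B)) ⟩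
      E * (n * (cA * (D * count (a ∷ w) (G ++ B))))
        ≤⟨ *-monoʳ-≤ E (*-monoʳ-≤ n (*-monoʳ-≤ cA (small-layers-negligible D j pos-w G B D*G≤n GB≤n))) ⟩
      E * (n * (cA * (D * cB + sum G * (n ^ suc j * n ^ sum w))))
        ≡⟨ rearr₂ E n cA D cB (sum G * (n ^ suc j * n ^ sum w)) ⟩
      E * (D * (n * (cA * cB))) + E * (n * (cA * (sum G * (n ^ suc j * n ^ sum w))))
        ≤⟨ +-mono-≤ (*-monoˡ-≤ (D * (n * (cA * cB))) (n≤1+n E)) (*-monoʳ-≤ E small) ⟩
      suc E * (D * (n * (cA * cB))) + E * n ^ m ∎))
      where
      cA = count u A
      cB = count (a ∷ w) B
      pos′ = subst (All (1 ≤_)) eq pos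
      tail² : ∀ {l l′ w} → All (1 ≤_) (l ∷ l′ ∷ w) → All (1 ≤_) w
      tail² (_ ∷ _ ∷ p) = p
      pos-w : All (1 ≤_) w
      pos-w = tail² (++⁻ʳ u pos′)
      cancelled : n ^ m ≤ E * (n * (cA * count (a ∷ w) (G ++ B)))
      cancelled = *-cancelˡ-≤ g {{>-nonZero 1≤g}} (subst (g * n ^ m ≤_)
        (trans (cong (λ t → E * (n * (cA * (t * count (a ∷ w) (G ++ B))))) (nC1≡n g)) (rearr E n cA g _)) le)
        where
        rearr : ∀ e n c g f → e * (n * (c * (g * f))) ≡ g * (e * (n * (c * f)))
        rearr = solve-∀
      small : n * (cA * (sum G * (n ^ suc j * n ^ sum w))) ≤ n ^ m
      small = begin
        n * (cA * (sum G * (n ^ suc j * n ^ sum w)))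
          ≤⟨ *-monoʳ-≤ n (*-mono-≤ (count≤ (++⁻ˡ u pos′) A A≤n)
               (*-monoˡ-≤ (n ^ suc j * n ^ sum w) (≤-trans (m≤m+n (sum G) (sum B)) (subst (_≤ n) (sum-++ G B) GB≤n)))) ⟩
        n * (n ^ sum u * (n * (n ^ suc j * n ^ sum w)))
          ≡⟨ rearr n (n ^ sum u) (n ^ suc j) (n ^ sum w) ⟩
        n ^ sum u * (n ^ 1 * (n ^ a * n ^ sum w))
          ≡⟨ cong (λ t → n ^ sum u * (n ^ 1 * t)) (sym (^-distribˡ-+-* n a (sum w))) ⟩
        n ^ sum u * (n ^ 1 * n ^ sum (a ∷ w))
          ≡⟨ sym (split-degree n u 1 (a ∷ w) eq) ⟩
        n ^ m ∎
        where
        rearr : ∀ n p q r → n * (p * (n * (q * r))) ≡ p * (n * 1 * (n * q * r))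
        rearr = solve-∀
      rearr₁ : ∀ d e n c x → d * (e * (n * (c * x))) ≡ e * (n * (c * (d * x)))
      rearr₁ = solve-∀
      rearr₂ : ∀ e n c d b s → e * (n * (c * (d * b + s))) ≡ e * (d * (n * (c * b))) + e * (n * (c * s))
      rearr₂ = solve-∀

    -- The pattern is cut around a layer of size one, whose two neighbours of size a are kept
    -- visible: either of them can later be handed to the merged block.
    Abundant : List ℕ → List ℕ → Set
    Abundant u w = ls ≡ (u ++ [ a ]) ++ 1 ∷ a ∷ w ×
      n ^ m ≤ D * (n * (count (u ++ [ a ]) A * count (a ∷ w) B))

    abundant-at-one : ∀ u w → ls ≡ u ++ 1 ∷ w → (∃[ w′ ] w ≡ a ∷ w′) → (∃[ u′ ] u ≡ u′ ++ [ a ]) →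
      g * n ^ m ≤ E * (n * (count u A * ((g C 1) * count w (G ++ B)))) →
      ∃[ u ] ∃[ w ] Abundant u w
    abundant-at-one .(u′ ++ [ a ]) .(a ∷ w′) eq (w′ , refl) (u′ , refl) le =
      u′ , w′ , eq , abundant-from (u′ ++ [ a ]) w′ eq le

    abundant-at : ∀ u v → ls ≡ u ++ v → All (1 ≤_) v →
      g * n ^ m ≤ E * (n * (count u A * startingAt g (G ++ B) v)) →
      ∃[ u ] ∃[ w ] Abundant u w
    abundant-at u []                _  _        le =
      ⊥-elim (<⇒≱ g*n^m>0 (subst (g * n ^ m ≤_) (rearr E n (count u A)) le))
      where
      rearr : ∀ e n c → e * (n * (c * 0)) ≡ 0
      rearr = solve-∀
    abundant-at u (0 ∷ w)           _  (() ∷ _) _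
    abundant-at u (1 ∷ w)           eq _        le = abundant-at-one u w eq (one-followed u w eq) (one-preceded u w eq) le
    abundant-at u (suc (suc l) ∷ w) eq _        le = ⊥-elim (not-big u l w eq le)

    abundant : ∃[ u ] ∃[ w ] Abundant u w
    abundant =
      let u , v , eq , le = heavy-split
      in abundant-at u v eq (++⁻ʳ u (subst (All (1 ≤_)) eq pos)) le

  -- Some block X of a consecutive layers of the run is light compared with the layers of
  -- the run on one of its two sides. A point of that side can then play the layer of size
  -- one of an abundant split, and X the adjacent layer of size a.
  module Block (A : List ℕ) (g : ℕ) (G B : List ℕ) (n : ℕ) (sum≡ : sum (A ++ g ∷ G ++ B) ≡ n)
               (pos-p : All (1 ≤_) (A ++ g ∷ G ++ B)) (light : D * sum (g ∷ G) ≤ n)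
               (max : Maximal ls (A ++ g ∷ G ++ B)) (m≤n : m ≤ n)
               (G₁ : List ℕ) (x y : ℕ) (X G₃ : List ℕ) (eqG : g ∷ G ≡ G₁ ++ (x ∷ y ∷ X) ++ G₃)
               (lenX : length (x ∷ y ∷ X) ≡ a)
               (light-X : suc (suc (M + M)) * sum (x ∷ y ∷ X) ≤ sum (g ∷ G)) where

    p = A ++ g ∷ G ++ B
    1≤g : 1 ≤ g
    1≤g with 1≤g ∷ _ ← ++⁻ʳ A pos-p = 1≤g
    pos-AGB : ∀ A → All (1 ≤_) (A ++ g ∷ G ++ B) → All (1 ≤_) (A ++ G ++ B)
    pos-AGB []      (_ ∷ q) = q
    pos-AGB (_ ∷ A) (q ∷ qs) = q ∷ pos-AGB A qs
    lower : n ^ m ≤ c₀ * count ls p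
    lower = subst (λ n → n ^ m ≤ c₀ * count ls p) sum≡
      (maximal-lower (suc j) ls′ p pos max (subst (m ≤_) (sym sum≡) m≤n))
    share : g * count ls p ≤ n * through ls A g (G ++ B)
    share = subst (λ n → g * count ls p ≤ n * through ls A g (G ++ B)) sum≡
      (layer-share (suc j) ls′ A g (G ++ B) (pos-AGB A pos-p) max)
    open Run A g G B 1≤g n sum≡ light lower share
    AA BB Y : List ℕ
    AA = A ++ G₁
    BB = G₃ ++ B
    Y  = x ∷ y ∷ X
    p≡ : p ≡ AA ++ Y ++ BB
    p≡ = trans (cong (λ G → A ++ G ++ B) eqG)
      (trans (cong (A ++_) (trans (++-assoc G₁ (Y ++ G₃) B) (cong (G₁ ++_) (++-assoc Y G₃ B))))
             (sym (++-assoc A G₁ (Y ++ BB))))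
    sumG≡ : sum (g ∷ G) ≡ sum G₁ + (sum Y + sum G₃)
    sumG≡ = trans (cong sum eqG) (trans (sum-++ G₁ (Y ++ G₃)) (cong (sum G₁ +_) (sum-++ Y G₃)))
    pos-Y++BB : All (1 ≤_) (Y ++ BB)
    pos-Y++BB = ++⁻ʳ AA (subst (All (1 ≤_)) p≡ pos-p)
    pos-AA : All (1 ≤_) AA
    pos-AA = ++⁻ˡ AA (subst (All (1 ≤_)) p≡ pos-p)
    pos-Y : All (1 ≤_) Y
    pos-Y = ++⁻ˡ Y pos-Y++BB
    sums : sum AA + sum (Y ++ BB) ≡ n
    sums = trans (sym (sum-++ AA (Y ++ BB))) (trans (cong sum (sym p≡)) sum≡)
    a≤sumY : a ≤ sum Y
    a≤sumY = subst (_≤ sum Y) lenX (length≤sum pos-Y)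

    unfavourable : ∀ U V (ls≡ : ls ≡ U ++ a ∷ V) → Favourable U V ls≡ n (sum Y) AA BB → ⊥
    unfavourable U V ls≡ fav with 1≤x ∷ pos-yX ← pos-Y =
      <⇒≱ (merge-block U V ls≡ n x y X AA BB 1≤x pos-yX
            (subst (sum AA ≤_) sums (m≤m+n _ _)) (subst (sum (Y ++ BB) ≤_) sums (m≤n+m _ (sum AA))) a≤sumY fav)
        (≤-trans (max (AA ++ sum Y ∷ BB)
                   (++⁺ pos-AA (≤-trans (s≤s z≤n) a≤sumY ∷ ++⁻ʳ Y pos-Y++BB))
                   (begin-equality
                     sum (AA ++ sum Y ∷ BB)     ≡⟨ sum-++ AA (sum Y ∷ BB) ⟩
                     sum AA + (sum Y + sum BB)  ≡⟨ cong (sum AA +_) (sym (sum-++ Y BB)) ⟩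
                     sum AA + sum (Y ++ BB)     ≡⟨ trans sums (sym sum≡) ⟩
                     sum p                      ∎))
                 (≤-reflexive (cong (count ls) p≡)))

    -- The origin of M = D k₁: k₁ is the number of splits in the loss bound and D is the constant of
    -- `Abundant`. S is the weight of the heavy side.
    favourable : ∀ S κ → M * sum Y < S → S * n ^ m ≤ D * (n ^ suc a * κ) →
      k₁ * sum Y * n ^ m < n ^ suc a * κ
    favourable S κ lt le = *-cancelˡ-< D _ _ (begin-strict
      D * (k₁ * sum Y * n ^ m)   ≡⟨ rearr D k₁ (sum Y) (n ^ m) ⟩
      M * sum Y * n ^ m          <⟨ *-monoˡ-< (n ^ m) {{m^n≢0 n m}} lt ⟩
      S * n ^ m                  ≤⟨ le ⟩
      D * (n ^ suc a * κ)        ∎)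
      where
      rearr : ∀ d k s t → d * (k * s * t) ≡ d * k * s * t
      rearr = solve-∀

    -- A point of G₃ plays the layer of size one and Y plays the layer of size a before it. Removing
    -- that layer from A costs a factor n^a, which together with the n of `Abundant` gives
    -- `n ^ suc a`.
    right-heavy : ∀ u w → Abundant u w → M * sum Y < sum G₃ → ⊥
    right-heavy u w (eq , le) lt = unfavourable u (1 ∷ a ∷ w) (trans eq (++-assoc u [ a ] (1 ∷ a ∷ w)))
        (favourable (sum G₃) (count u AA * count (1 ∷ a ∷ w) BB) lt (begin
      sum G₃ * n ^ m
        ≤⟨ *-monoʳ-≤ (sum G₃) le ⟩
      sum G₃ * (D * (n * (count (u ++ [ a ]) A * count (a ∷ w) B)))
        ≤⟨ *-monoʳ-≤ (sum G₃) (*-monoʳ-≤ D (*-monoʳ-≤ n (*-monoˡ-≤ (count (a ∷ w) B)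
             (≤-trans (count-snoc≤ u (suc j) A)
               (*-mono-≤ (count-++ʳ u A G₁) (^-monoˡ-≤ a A≤n)))))) ⟩
      sum G₃ * (D * (n * (count u AA * n ^ a * count (a ∷ w) B)))
        ≡⟨ rearr (sum G₃) D n (count u AA) (n ^ a) (count (a ∷ w) B) ⟩
      D * (n ^ suc a * (count u AA * (sum G₃ * count (a ∷ w) B)))
        ≤⟨ *-monoʳ-≤ D (*-monoʳ-≤ (n ^ suc a) (*-monoʳ-≤ (count u AA)
             (subst (λ s → s * count (a ∷ w) B ≤ count (1 ∷ a ∷ w) BB) (count-[1] G₃)
               (count-super [ 1 ] (a ∷ w) G₃ B)))) ⟩
      D * (n ^ suc a * (count u AA * count (1 ∷ a ∷ w) BB)) ∎))
      where
      rearr : ∀ s d n c p f → s * (d * (n * (c * p * f))) ≡ d * (n * p * (c * (s * f)))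
      rearr = solve-∀

    -- Symmetrically, a point of G₁ plays the layer of size one and Y the layer of size a after it,
    -- which is removed from B.
    left-heavy : ∀ u w → Abundant u w → M * sum Y < sum G₁ → ⊥
    left-heavy u w (eq , le) lt = unfavourable ((u ++ [ a ]) ++ [ 1 ]) w (trans eq (sym (++-assoc (u ++ [ a ]) [ 1 ] (a ∷ w))))
        (favourable (sum G₁) (count ((u ++ [ a ]) ++ [ 1 ]) AA * count w BB) lt (begin
      sum G₁ * n ^ m
        ≤⟨ *-monoʳ-≤ (sum G₁) le ⟩
      sum G₁ * (D * (n * (cA * count (a ∷ w) B)))
        ≤⟨ *-monoʳ-≤ (sum G₁) (*-monoʳ-≤ D (*-monoʳ-≤ n (*-monoʳ-≤ cA
             (≤-trans (count-cons≤ (suc j) w B)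
               (*-mono-≤ (^-monoˡ-≤ a B≤n) (count-++ˡ w G₃ B)))))) ⟩
      sum G₁ * (D * (n * (cA * (n ^ a * count w BB))))
        ≡⟨ rearr (sum G₁) D n cA (n ^ a) (count w BB) ⟩
      D * (n ^ suc a * (cA * sum G₁ * count w BB))
        ≤⟨ *-monoʳ-≤ D (*-monoʳ-≤ (n ^ suc a) (*-monoˡ-≤ (count w BB)
             (subst (λ s → cA * s ≤ count ((u ++ [ a ]) ++ [ 1 ]) AA) (count-[1] G₁)
               (count-super (u ++ [ a ]) [ 1 ] A G₁)))) ⟩
      D * (n ^ suc a * (count ((u ++ [ a ]) ++ [ 1 ]) AA * count w BB)) ∎))
      where
      cA = count (u ++ [ a ]) A
      B≤n : sum B ≤ n
      B≤n = ≤-trans (≤-trans (m≤n+m (sum B) (sum G)) (≤-reflexive (sym (sum-++ G B)))) GB≤n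
      rearr : ∀ s d n c p f → s * (d * (n * (c * (p * f)))) ≡ d * (n * p * (c * s * f))
      rearr = solve-∀

    -- The run would weigh at most 2M + 1 times Y, whereas Y was chosen with at most one part in 2M
    -- + 2.
    balanced : sum G₁ ≤ M * sum Y → sum G₃ ≤ M * sum Y → ⊥
    balanced le₁ le₃ = <⇒≱ (≤-trans (s≤s z≤n) a≤sumY) (+-cancelˡ-≤ (sum Y + (M + M) * sum Y) _ _ (begin
      sum Y + (M + M) * sum Y + sum Y      ≡⟨ rearr₁ (sum Y) M ⟩
      suc (suc (M + M)) * sum Y            ≤⟨ light-X ⟩
      sum (g ∷ G)                          ≡⟨ sumG≡ ⟩
      sum G₁ + (sum Y + sum G₃)            ≤⟨ +-mono-≤ le₁ (+-monoʳ-≤ (sum Y) le₃) ⟩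
      M * sum Y + (sum Y + M * sum Y)      ≡⟨ rearr₂ (sum Y) M ⟩
      sum Y + (M + M) * sum Y + 0          ∎))
      where
      rearr₁ : ∀ s M → s + (M + M) * s + s ≡ suc (suc (M + M)) * s
      rearr₁ = solve-∀
      rearr₂ : ∀ s M → M * s + (s + M * s) ≡ s + (M + M) * s + 0
      rearr₂ = solve-∀

    contradiction : ⊥
    contradiction =
      let u , w , split = abundant in
      case <-≤-connex (M * sum Y) (sum G₁) of λ where
        (inj₁ lt)  → left-heavy u w split lt
        (inj₂ le₁) → case <-≤-connex (M * sum Y) (sum G₃) of λ where
          (inj₁ lt)  → right-heavy u w split lt
          (inj₂ le₃) → balanced le₁ le₃

  no-light-run : ∀ A G B n → sum (A ++ G ++ B) ≡ n → All (1 ≤_) (A ++ G ++ B) →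
    suc (suc (M + M)) * a ≤ length G → D * sum G ≤ n →
    Maximal ls (A ++ G ++ B) → m ≤ n → ⊥
  no-light-run A (g ∷ G) B n sum≡ pos-p long light max m≤n =
    case light-chunk (suc (M + M)) a (g ∷ G) long of λ where
      (G₁ , x ∷ y ∷ X , G₃ , eqG , lenX , light-X) →
        Block.contradiction A g G B n sum≡ pos-p light max m≤n G₁ x y X G₃ eqG lenX light-X

  -- D runs of 2M + 2 blocks of a layers: the number of runs makes one run light compared with n,
  -- and the number of blocks makes one block light within its run.
  bound : ℕ
  bound = D * (suc (suc (M + M)) * a)

  few-layers : ∀ p → All (1 ≤_) p → Maximal ls p → m ≤ sum p → length p ≤ bound
  few-layers p pos-p max m≤n = ≮⇒≥ λ lt →
    let A , X , B , eq , len , light = light-chunk (E + E) (suc (suc (M + M)) * a) p (<⇒≤ lt)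
    in no-light-run A X B (sum p) (cong sum (sym eq)) (subst (All (1 ≤_)) eq pos-p)
         (≤-reflexive (sym len)) light (subst (Maximal ls) eq max) m≤n

-- Occurrences as words of layer indices

<⇒<ᵇ≡true : ∀ {x y} → x < y → (x <ᵇ y) ≡ true
<⇒<ᵇ≡true x<y = Equivalence.to T-≡ (<⇒<ᵇ x<y)

≮⇒<ᵇ≡false : ∀ {x y} → ¬ (x < y) → (x <ᵇ y) ≡ false
≮⇒<ᵇ≡false {x} {y} x≮y with x <ᵇ y in eq
... | false = refl
... | true  = ⊥-elim (x≮y (<ᵇ⇒< x y (Equivalence.from T-≡ eq)))

<ᵇ-irrefl : ∀ x → (x <ᵇ x) ≡ false
<ᵇ-irrefl x = ≮⇒<ᵇ≡false (<-irrefl {x} refl)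

≡ᵇ-refl : ∀ x → (x ≡ᵇ x) ≡ true
≡ᵇ-refl x = Equivalence.to T-≡ (≡⇒≡ᵇ x x refl)

≡ᵇ-true⇒≡ : ∀ x y → (x ≡ᵇ y) ≡ true → x ≡ y
≡ᵇ-true⇒≡ x y eq = ≡ᵇ⇒≡ x y (Equivalence.from T-≡ eq)

≢⇒≡ᵇ-false : ∀ {x y} → x ≢ y → (x ≡ᵇ y) ≡ false
≢⇒≡ᵇ-false {x} {y} x≢y with x ≡ᵇ y in eq
... | false = refl
... | true  = ⊥-elim (x≢y (≡ᵇ-true⇒≡ x y eq))

blockOf-< : ∀ l ls {x} → x < l → blockOf (l ∷ ls) x ≡ 0
blockOf-< l ls x<l rewrite <⇒<ᵇ≡true x<l = refl

blockOf-+ : ∀ l ls x → blockOf (l ∷ ls) (l + x) ≡ suc (blockOf ls x)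
blockOf-+ l ls x rewrite ≮⇒<ᵇ≡false (m+n≮m l x) | m+n∸m≡n l x = refl

blockOf-mono : ∀ ls {x y} → x ≤ y → blockOf ls x ≤ blockOf ls y
blockOf-mono []       x≤y = z≤n
blockOf-mono (l ∷ ls) {x} {y} x≤y with x <ᵇ l in eqx | y <ᵇ l in eqy
... | true  | _     = z≤n
... | false | false = s≤s (blockOf-mono ls (∸-monoˡ-≤ l x≤y))
... | false | true
  with () ← trans (sym eqx) (<⇒<ᵇ≡true (≤-<-trans x≤y (<ᵇ⇒< y l (Equivalence.from T-≡ eqy))))

-- A direct sum of decreasing permutations. It realises every list of sizes, as the competitors
-- require.
layered : ∀ ls → Perm (sum ls)
layered []       = ↔-id _
layered (l ∷ ls) = ↔-sym (+↔⊎ {l}) ↔-∘ ((reverse {l} ⊎-↔ layered ls) ↔-∘ +↔⊎ {l})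

layered-↑ˡ : ∀ l ls i → toℕ (layered (l ∷ ls) ⟨$⟩ʳ (i ↑ˡ sum ls)) ≡ toℕ (opposite i)
layered-↑ˡ l ls i rewrite splitAt-↑ˡ l i (sum ls) = toℕ-↑ˡ (opposite i) (sum ls)

layered-↑ʳ : ∀ l ls i → toℕ (layered (l ∷ ls) ⟨$⟩ʳ (l ↑ʳ i)) ≡ l + toℕ (layered ls ⟨$⟩ʳ i)
layered-↑ʳ l ls i rewrite splitAt-↑ʳ l (sum ls) i = toℕ-↑ʳ l (layered ls ⟨$⟩ʳ i)

opposite-anti : ∀ {l} (i j : Fin l) → toℕ i < toℕ j → toℕ (opposite j) < toℕ (opposite i)
opposite-anti {l} i j i<j = subst₂ _<_ (sym (opposite-prop j)) (sym (opposite-prop i))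
  (∸-monoʳ-< (s≤s i<j) (toℕ<n j))

data Split (l s : ℕ) : Fin (l + s) → Set where
  left  : ∀ i → Split l s (i ↑ˡ s)
  right : ∀ i → Split l s (l ↑ʳ i)

split : ∀ l s x → Split l s x
split l s x with splitAt l x in eq
... | inj₁ i = subst (Split l s) (splitAt⁻¹-↑ˡ eq) (left i)
... | inj₂ i = subst (Split l s) (splitAt⁻¹-↑ʳ {l} eq) (right i)

layered-isLayered : ∀ ls → All (1 ≤_) ls → IsLayered (layered ls) ls
layered-isLayered ls pos = refl , pos , ordered ls
  where
  ordered : ∀ ls (x y : Fin (sum ls)) → toℕ x < toℕ y →
    (blockOf ls (toℕ x) ≡ blockOf ls (toℕ y) → toℕ (layered ls ⟨$⟩ʳ y) < toℕ (layered ls ⟨$⟩ʳ x)) ×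
    (blockOf ls (toℕ x) < blockOf ls (toℕ y) → toℕ (layered ls ⟨$⟩ʳ x) < toℕ (layered ls ⟨$⟩ʳ y))
  ordered (l ∷ ls) x y x<y with split l (sum ls) x | split l (sum ls) y
  ... | left i  | left j
    rewrite layered-↑ˡ l ls i | layered-↑ˡ l ls j | toℕ-↑ˡ i (sum ls) | toℕ-↑ˡ j (sum ls)
          | blockOf-< l ls (toℕ<n i) | blockOf-< l ls (toℕ<n j)
    = (λ _ → opposite-anti i j x<y) , λ ()
  ... | left i  | right j
    rewrite layered-↑ˡ l ls i | layered-↑ʳ l ls j | toℕ-↑ˡ i (sum ls) | toℕ-↑ʳ l j
          | blockOf-< l ls (toℕ<n i) | blockOf-+ l ls (toℕ j)
    = (λ ()) , λ _ → <-≤-trans (toℕ<n (opposite i)) (m≤m+n l _)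
  ... | right i | left j
    rewrite toℕ-↑ˡ j (sum ls) | toℕ-↑ʳ l i
    = ⊥-elim (<⇒≱ (toℕ<n j) (≤-trans (m≤m+n l (toℕ i)) (<⇒≤ x<y)))
  ... | right i | right j
    rewrite layered-↑ʳ l ls i | layered-↑ʳ l ls j | toℕ-↑ʳ l i | toℕ-↑ʳ l j
          | blockOf-+ l ls (toℕ i) | blockOf-+ l ls (toℕ j)
    = (λ eq → +-monoʳ-< l (proj₁ rec (suc-injective eq))) , (λ lt → +-monoʳ-< l (proj₂ rec (s≤s⁻¹ lt)))
    where rec = ordered ls i j (+-cancelˡ-< l _ _ x<y)

-- Counting subwords that match a pattern

tally : {A : Set} → (A → Bool) → List A → ℕ
tally P []       = 0
tally P (x ∷ xs) = (if P x then 1 else 0) + tally P xs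

length-filterᵇ : {A : Set} (P : A → Bool) (xs : List A) → length (filterᵇ P xs) ≡ tally P xs
length-filterᵇ P []       = refl
length-filterᵇ P (x ∷ xs) with P x
... | true  = cong suc (length-filterᵇ P xs)
... | false = length-filterᵇ P xs

tally-++ : {A : Set} (P : A → Bool) (xs ys : List A) → tally P (xs ++ ys) ≡ tally P xs + tally P ys
tally-++ P []       ys = refl
tally-++ P (x ∷ xs) ys =
  trans (cong ((if P x then 1 else 0) +_) (tally-++ P xs ys)) (sym (+-assoc (if P x then 1 else 0) _ _))

tally-map : {A B : Set} (P : B → Bool) (f : A → B) (xs : List A) → tally P (map f xs) ≡ tally (P ∘ f) xs
tally-map P f []       = refl
tally-map P f (x ∷ xs) = cong ((if P (f x) then 1 else 0) +_) (tally-map P f xs)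

tally-cong : {A : Set} {P Q : A → Bool} {xs : List A} → All (λ x → P x ≡ Q x) xs → tally P xs ≡ tally Q xs
tally-cong []         = refl
tally-cong (eq ∷ eqs) = cong₂ (λ b t → (if b then 1 else 0) + t) eq (tally-cong eqs)

tally-false : {A : Set} (xs : List A) → tally (λ _ → false) xs ≡ 0
tally-false []       = refl
tally-false (x ∷ xs) = tally-false xs

tally-subst : {A : Set} (P : Bool → A → Bool) {b c : Bool} (xs : List A) → b ≡ c →
  tally (P b) xs ≡ tally (P c) xs
tally-subst P xs refl = refl

tally-choose : ∀ {A : Set} {m} (P : Vec A (suc m) → Bool) x xs →
  tally P (choose (suc m) (x ∷ xs)) ≡ tally (P ∘ (x ∷_)) (choose m xs) + tally P (choose (suc m) xs)
tally-choose {m = m} P x xs = trans (tally-++ P (map (x ∷_) (choose m xs)) _)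
  (cong (_+ tally P (choose (suc m) xs)) (tally-map P (x ∷_) (choose m xs)))

choose-map : {A B : Set} (f : A → B) (m : ℕ) (xs : List A) →
  choose m (map f xs) ≡ map (Vec.map f) (choose m xs)
choose-map f zero    xs       = refl
choose-map f (suc m) []       = refl
choose-map f (suc m) (x ∷ xs) = trans
  (cong₂ (λ s t → map (f x ∷_) s ++ t) (choose-map f m xs) (choose-map f (suc m) xs))
  (trans
    (cong (_++ map (Vec.map f) (choose (suc m) xs)) (trans (sym (map-∘ (choose m xs))) (map-∘ (choose m xs))))
    (sym (map-++ (Vec.map f) (map (x ∷_) (choose m xs)) (choose (suc m) xs))))

-- The automaton states "r more letters equal to x, then the pattern ls, whose first
-- letter must differ from x" (scan x (r ∷ ls)) and "the pattern ls" (matches ls); letters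
-- are the indices of the layers of the host permutation.
scan : ∀ {m} → ℕ → List ℕ → Vec ℕ m → Bool
scan x (suc r ∷ ls)         (y ∷ w) = (y ≡ᵇ x) ∧ scan x (r ∷ ls) w
scan x (zero  ∷ suc l ∷ ls) (y ∷ w) = not (y ≡ᵇ x) ∧ scan y (l ∷ ls) w
scan x (zero ∷ [])          []      = true
scan _ _                    _       = false

matches : ∀ {m} → List ℕ → Vec ℕ m → Bool
matches (suc l ∷ ls) (y ∷ w) = scan y (l ∷ ls) w
matches []           []      = true
matches _            _       = false

Avoids : ℕ → List ℕ → Set
Avoids x = All (λ y → (y ≡ᵇ x) ≡ false)

tally-scan-suc-avoid : ∀ x r ls c → Avoids x c → tally (scan x (suc r ∷ ls)) (choose (suc r + sum ls) c) ≡ 0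
tally-scan-suc-avoid x r ls []      _            = refl
tally-scan-suc-avoid x r ls (y ∷ c) (y≢x ∷ av) = trans (tally-choose (scan x (suc r ∷ ls)) y c)
  (cong₂ _+_ (trans (tally-subst (λ b w → b ∧ scan x (r ∷ ls) w) (choose (r + sum ls) c) y≢x) (tally-false (choose (r + sum ls) c)))
             (tally-scan-suc-avoid x r ls c av))

tally-scan-zero-avoid : ∀ x {ls} → All (1 ≤_) ls → ∀ c → Avoids x c →
  tally (scan x (0 ∷ ls)) (choose (sum ls) c) ≡ tally (matches ls) (choose (sum ls) c)
tally-scan-zero-avoid x []      c       _          = refl
tally-scan-zero-avoid x {suc l ∷ ls} (_ ∷ _) []      _          = refl
tally-scan-zero-avoid x {suc l ∷ ls} pos@(_ ∷ _) (y ∷ c) (y≢x ∷ av) = begin-equality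
  tally (scan x (0 ∷ suc l ∷ ls)) (choose (suc l + sum ls) (y ∷ c))
    ≡⟨ tally-choose (scan x (0 ∷ suc l ∷ ls)) y c ⟩
  tally (λ w → not (y ≡ᵇ x) ∧ scan y (l ∷ ls) w) (choose (l + sum ls) c)
    + tally (scan x (0 ∷ suc l ∷ ls)) (choose (suc l + sum ls) c)
    ≡⟨ cong₂ _+_ (tally-subst (λ b w → not b ∧ scan y (l ∷ ls) w) (choose (l + sum ls) c) y≢x)
                 (tally-scan-zero-avoid x pos c av) ⟩
  tally (scan y (l ∷ ls)) (choose (l + sum ls) c) + tally (matches (suc l ∷ ls)) (choose (suc l + sum ls) c)
    ≡⟨ sym (tally-choose (matches (suc l ∷ ls)) y c) ⟩
  tally (matches (suc l ∷ ls)) (choose (suc l + sum ls) (y ∷ c)) ∎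

-- All copies of x stand in front and c avoids x. Hence the r missing letters are chosen among the p
-- copies, and the next pattern layer, which must use another letter, starts in c.
tally-scan : ∀ x r {ls} → All (1 ≤_) ls → ∀ p c → Avoids x c →
  tally (scan x (r ∷ ls)) (choose (r + sum ls) (replicate p x ++ c))
    ≡ (p C r) * tally (matches ls) (choose (sum ls) c)
tally-scan x zero    pos zero    c av = trans (tally-scan-zero-avoid x pos c av) (sym (*-identityˡ _))
tally-scan x (suc r) {ls} pos zero c av = tally-scan-suc-avoid x r ls c av
tally-scan x zero    []  (suc p) c av = refl
tally-scan x zero {suc l ∷ ls} pos@(_ ∷ _) (suc p) c av = trans
  (tally-choose (scan x (0 ∷ suc l ∷ ls)) x (replicate p x ++ c))
  (cong₂ _+_ (trans (tally-subst (λ b w → not b ∧ scan x (l ∷ ls) w) (choose (l + sum ls) (replicate p x ++ c)) (≡ᵇ-refl x)) (tally-false (choose (l + sum ls) (replicate p x ++ c))))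
             (tally-scan x zero pos p c av))
tally-scan x (suc r) {ls} pos (suc p) c av = begin-equality
  tally (scan x (suc r ∷ ls)) (choose (suc r + sum ls) (x ∷ replicate p x ++ c))
    ≡⟨ tally-choose (scan x (suc r ∷ ls)) x (replicate p x ++ c) ⟩
  tally (λ w → (x ≡ᵇ x) ∧ scan x (r ∷ ls) w) (choose (r + sum ls) (replicate p x ++ c))
    + tally (scan x (suc r ∷ ls)) (choose (suc r + sum ls) (replicate p x ++ c))
    ≡⟨ cong₂ _+_ (trans (tally-subst (λ b w → b ∧ scan x (r ∷ ls) w) (choose (r + sum ls) (replicate p x ++ c)) (≡ᵇ-refl x))
                        (tally-scan x r pos p c av))
                 (tally-scan x (suc r) pos p c av) ⟩
  (p C r) * N + (p C suc r) * N
    ≡⟨ sym (*-distribʳ-+ N (p C r) (p C suc r)) ⟩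
  (p C r + p C suc r) * N
    ≡⟨ cong (_* N) (sym (pascal p r)) ⟩
  (suc p C suc r) * N ∎
  where
  N = tally (matches ls) (choose (sum ls) c)

-- A match either begins with the first copy of x or avoids that copy. Pascal's rule adds up the two
-- cases, which yields the recursion of `count`.
tally-matches : ∀ x l {ls} → All (1 ≤_) ls → ∀ p c → Avoids x c →
  tally (matches (suc l ∷ ls)) (choose (suc l + sum ls) (replicate p x ++ c))
    ≡ (p C suc l) * tally (matches ls) (choose (sum ls) c) + tally (matches (suc l ∷ ls)) (choose (suc l + sum ls) c)
tally-matches x l pos zero    c av = refl
tally-matches x l {ls} pos (suc p) c av = begin-equality
  tally (matches (suc l ∷ ls)) (choose (suc l + sum ls) (x ∷ replicate p x ++ c))
    ≡⟨ tally-choose (matches (suc l ∷ ls)) x (replicate p x ++ c) ⟩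
  tally (scan x (l ∷ ls)) (choose (l + sum ls) (replicate p x ++ c))
    + tally (matches (suc l ∷ ls)) (choose (suc l + sum ls) (replicate p x ++ c))
    ≡⟨ cong₂ _+_ (tally-scan x l pos p c av) (tally-matches x l pos p c av) ⟩
  (p C l) * N + ((p C suc l) * N + N′)
    ≡⟨ sym (+-assoc ((p C l) * N) _ N′) ⟩
  (p C l) * N + (p C suc l) * N + N′
    ≡⟨ cong (_+ N′) (trans (sym (*-distribʳ-+ N (p C l) (p C suc l))) (cong (_* N) (sym (pascal p l)))) ⟩
  (suc p C suc l) * N + N′ ∎
  where
  N  = tally (matches ls) (choose (sum ls) c)
  N′ = tally (matches (suc l ∷ ls)) (choose (suc l + sum ls) c)

labels : ℕ → List ℕ → List ℕ
labels b []       = []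
labels b (p ∷ ps) = replicate p b ++ labels (suc b) ps

labels-≥ : ∀ b ps → All (b ≤_) (labels b ps)
labels-≥ b []       = []
labels-≥ b (p ∷ ps) = ++⁺ (all-b p) (All.map (≤-trans (n≤1+n b)) (labels-≥ (suc b) ps))
  where
  all-b : ∀ p → All (b ≤_) (replicate p b)
  all-b zero    = []
  all-b (suc p) = ≤-refl ∷ all-b p

labels-avoid : ∀ b ps → Avoids b (labels (suc b) ps)
labels-avoid b ps = All.map (λ b<y → ≢⇒≡ᵇ-false (λ y≡b → <⇒≢ b<y (sym y≡b))) (labels-≥ (suc b) ps)

tally-labels : ∀ {ls} → All (1 ≤_) ls → ∀ b ps → tally (matches ls) (choose (sum ls) (labels b ps)) ≡ count ls ps
tally-labels []                       b ps       = refl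
tally-labels {suc l ∷ ls} (_ ∷ _)     b []       = refl
tally-labels {suc l ∷ ls} (1≤l ∷ pos) b (p ∷ ps) = trans
  (tally-matches b l pos p (labels (suc b) ps) (labels-avoid b ps))
  (cong₂ (λ s t → (p C suc l) * s + t) (tally-labels pos (suc b) ps) (tally-labels (1≤l ∷ pos) (suc b) ps))

blockOf-labels : ∀ b ps → tabulate {n = sum ps} (λ i → b + blockOf ps (toℕ i)) ≡ labels b ps
blockOf-labels b []           = refl
blockOf-labels b (zero ∷ ps)  = trans (tabulate-cong (λ i → +-suc b (blockOf ps (toℕ i)))) (blockOf-labels (suc b) ps)
blockOf-labels b (suc p ∷ ps) = cong₂ _∷_ (+-identityʳ b) (blockOf-labels b (p ∷ ps))

-- Only equalities of letters are recorded; the order of distinct letters comes from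
-- `WeaklyIncreasing`.
SamePattern : ∀ {m} → List ℕ → Vec ℕ m → Set
SamePattern {m} ls w = (i j : Fin m) →
  (lookup w i ≡ᵇ lookup w j) ≡ (blockOf ls (toℕ i) ≡ᵇ blockOf ls (toℕ j))

WeaklyIncreasing : ∀ {m} → Vec ℕ m → Set
WeaklyIncreasing {m} w = (i j : Fin m) → toℕ i < toℕ j → lookup w i ≤ lookup w j

WI-tail : ∀ {m x} {w : Vec ℕ m} → WeaklyIncreasing (x ∷ w) → WeaklyIncreasing w
WI-tail wi i j i<j = wi (suc i) (suc j) (s≤s i<j)

∧-true : ∀ {b c} → (b ∧ c) ≡ true → b ≡ true × c ≡ true
∧-true {true} {true} _ = refl , refl

repeat-first : ∀ {m} x r ls (w : Vec ℕ m) →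
  SamePattern (suc r ∷ ls) (x ∷ w) → SamePattern (suc (suc r) ∷ ls) (x ∷ x ∷ w)
repeat-first x r ls w same zero          zero          = same zero zero
repeat-first x r ls w same zero          (suc zero)    = same zero zero
repeat-first x r ls w same zero          (suc (suc j)) = same zero (suc j)
repeat-first x r ls w same (suc zero)    zero          = same zero zero
repeat-first x r ls w same (suc zero)    (suc j)       = same zero j
repeat-first x r ls w same (suc (suc i)) zero          = same (suc i) zero
repeat-first x r ls w same (suc (suc i)) (suc j)       = same (suc i) j

-- The automaton compares a letter only with its predecessor. In a weakly increasing word this
-- suffices: a letter that differs from its predecessor exceeds all earlier ones.
scan⇒same : ∀ {m} x r {ls} → All (1 ≤_) ls → (w : Vec ℕ m) → m ≡ r + sum ls →
  WeaklyIncreasing (x ∷ w) → scan x (r ∷ ls) w ≡ true → SamePattern (suc r ∷ ls) (x ∷ w)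
scan⇒same x zero    []  []      _  _  _  zero zero = ≡ᵇ-refl x
scan⇒same x (suc r) {ls} pos (y ∷ w) m≡ wi ok with ∧-true ok
... | y≡x , ok′ with refl ← ≡ᵇ-true⇒≡ y x y≡x =
  repeat-first x r ls w (scan⇒same x r pos w (suc-injective m≡) (WI-tail wi) ok′)
scan⇒same x zero {suc l ∷ ls} (_ ∷ pos) (y ∷ w) m≡ wi ok = same
  where
  y≢x : y ≢ x
  y≢x refl with () ← trans (sym (cong not (≡ᵇ-refl y))) (proj₁ (∧-true ok))
  below : ∀ j → x < lookup (y ∷ w) j
  below zero    = ≤∧≢⇒< (wi zero (suc zero) (s≤s z≤n)) (y≢x ∘ sym)
  below (suc j) = <-≤-trans (below zero) (wi (suc zero) (suc (suc j)) (s≤s (s≤s z≤n)))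
  rest : SamePattern (suc l ∷ ls) (y ∷ w)
  rest = scan⇒same y l pos w (suc-injective m≡) (WI-tail wi) (proj₂ (∧-true ok))
  same : SamePattern (1 ∷ suc l ∷ ls) (x ∷ y ∷ w)
  same zero    zero    = ≡ᵇ-refl x
  same zero    (suc j) = ≢⇒≡ᵇ-false (<⇒≢ (below j))
  same (suc i) zero    = ≢⇒≡ᵇ-false (<⇒≢ (below i) ∘ sym)
  same (suc i) (suc j) = rest i j

same⇒scan : ∀ {m} x r {ls} → All (1 ≤_) ls → (w : Vec ℕ m) → m ≡ r + sum ls →
  SamePattern (suc r ∷ ls) (x ∷ w) → scan x (r ∷ ls) w ≡ true
same⇒scan x zero    []  []      _  _    = refl
same⇒scan x (suc r) pos (y ∷ w) m≡ same with refl ← ≡ᵇ-true⇒≡ y x (same (suc zero) zero)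
  rewrite ≡ᵇ-refl x = same⇒scan x r pos w (suc-injective m≡) (λ i j → same (suc i) (suc j))
same⇒scan x zero {suc l ∷ ls} (_ ∷ pos) (y ∷ w) m≡ same rewrite same (suc zero) zero =
  same⇒scan y l pos w (suc-injective m≡) (λ i j → same (suc i) (suc j))

matches-same : ∀ {ls} → All (1 ≤_) ls → (w : Vec ℕ (sum ls)) → WeaklyIncreasing w →
  matches ls w ≡ true ⇔ SamePattern ls w
matches-same []                   []      _  = mk⇔ (λ _ ()) (λ _ → refl)
matches-same {suc l ∷ ls} (_ ∷ pos) (x ∷ w) wi = mk⇔ (scan⇒same x l pos w refl wi) (same⇒scan x l pos w refl)

-- Patterns induced in layered permutations

all-tabulate⇔ : ∀ {A : Set} {n} (P : A → Bool) (f : Fin n → A) →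
  all P (tabulate f) ≡ true ⇔ (∀ i → P (f i) ≡ true)
all-tabulate⇔ {n = n} P f = mk⇔ (to n f) (from n f)
  where
  to : ∀ n (f : Fin n → _) → all P (tabulate f) ≡ true → ∀ i → P (f i) ≡ true
  to (suc n) f ok zero    = proj₁ (∧-true ok)
  to (suc n) f ok (suc i) = to n (f ∘ suc) (proj₂ (∧-true ok)) i
  from : ∀ n (f : Fin n → _) → (∀ i → P (f i) ≡ true) → all P (tabulate f) ≡ true
  from zero    f ok = refl
  from (suc n) f ok rewrite ok zero = from n (f ∘ suc) (ok ∘ suc)

==ᵇ⇒≡ : ∀ {b c} → (b ==ᵇ c) ≡ true → b ≡ c
==ᵇ⇒≡ {true}  {true}  _ = refl
==ᵇ⇒≡ {false} {false} _ = refl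

==ᵇ-refl : ∀ b → (b ==ᵇ b) ≡ true
==ᵇ-refl true  = refl
==ᵇ-refl false = refl

induces⇔ : ∀ {m n} (σ : Perm m) (π : Perm n) (v : Vec (Fin n) m) → induces σ π v ≡ true ⇔
  ((i j : Fin m) → (toℕ (π ⟨$⟩ʳ lookup v i) <ᵇ toℕ (π ⟨$⟩ʳ lookup v j)) ≡ (toℕ (σ ⟨$⟩ʳ i) <ᵇ toℕ (σ ⟨$⟩ʳ j)))
induces⇔ σ π v = mk⇔
  (λ ok i j → ==ᵇ⇒≡ (Equivalence.to (all-tabulate⇔ _ id) (Equivalence.to (all-tabulate⇔ _ id) ok i) j))
  (λ same → Equivalence.from (all-tabulate⇔ _ id) (λ i → Equivalence.from (all-tabulate⇔ _ id)
    (λ j → trans (cong (_==ᵇ (toℕ (σ ⟨$⟩ʳ i) <ᵇ toℕ (σ ⟨$⟩ʳ j))) (same i j)) (==ᵇ-refl (toℕ (σ ⟨$⟩ʳ i) <ᵇ toℕ (σ ⟨$⟩ʳ j))))))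

module _ {n} (π : Perm n) (ps : List ℕ) (lay : IsLayered π ps) where

  block : Fin n → ℕ
  block x = blockOf ps (toℕ x)

  -- Layer indices grow weakly with the position, so for ordered positions the order of the values
  -- says exactly whether the layers differ.
  value<ᵇ-forward : ∀ x y → toℕ x < toℕ y → (toℕ (π ⟨$⟩ʳ x) <ᵇ toℕ (π ⟨$⟩ʳ y)) ≡ not (block x ≡ᵇ block y)
  value<ᵇ-forward x y x<y with <-cmp (block x) (block y)
  ... | tri< lt ne _ rewrite ≢⇒≡ᵇ-false ne = <⇒<ᵇ≡true (proj₂ (proj₂ (proj₂ lay) x y x<y) lt)
  ... | tri≈ _ eq _ rewrite eq | ≡ᵇ-refl (block y) = ≮⇒<ᵇ≡false (<⇒≯ (proj₁ (proj₂ (proj₂ lay) x y x<y) eq))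
  ... | tri> _ _ gt = ⊥-elim (<⇒≱ gt (blockOf-mono ps (<⇒≤ x<y)))

  value<ᵇ-backward : ∀ x y → toℕ x < toℕ y → (toℕ (π ⟨$⟩ʳ y) <ᵇ toℕ (π ⟨$⟩ʳ x)) ≡ (block y ≡ᵇ block x)
  value<ᵇ-backward x y x<y with <-cmp (block x) (block y)
  ... | tri< lt ne _ rewrite ≢⇒≡ᵇ-false (ne ∘ sym) = ≮⇒<ᵇ≡false (<⇒≯ (proj₂ (proj₂ (proj₂ lay) x y x<y) lt))
  ... | tri≈ _ eq _ rewrite eq | ≡ᵇ-refl (block y) = <⇒<ᵇ≡true (proj₁ (proj₂ (proj₂ lay) x y x<y) eq)
  ... | tri> _ _ gt = ⊥-elim (<⇒≱ gt (blockOf-mono ps (<⇒≤ x<y)))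

Increasing : ∀ {m n} → Vec (Fin n) m → Set
Increasing {m} v = (i j : Fin m) → toℕ i < toℕ j → toℕ (lookup v i) < toℕ (lookup v j)

-- On both sides every comparison of values reduces to an equality of layer indices, so σ is induced
-- exactly when these equalities agree.
induces⇔same : ∀ {n ls ps} (σ : Perm (sum ls)) (π : Perm n) → IsLayered σ ls → IsLayered π ps →
  (v : Vec (Fin n) (sum ls)) → Increasing v →
  induces σ π v ≡ true ⇔ SamePattern ls (Vec.map (λ x → blockOf ps (toℕ x)) v)
induces⇔same {n} {ls} {ps} σ π layσ layπ v inc = mk⇔ to from
  where
  bσ : Fin (sum ls) → ℕ
  bσ i = blockOf ls (toℕ i)
  bπ : Fin n → ℕ
  bπ x = blockOf ps (toℕ x)
  look : ∀ i → lookup (Vec.map bπ v) i ≡ bπ (lookup v i)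
  look i = lookup-map i bπ v
  to : induces σ π v ≡ true → SamePattern ls (Vec.map bπ v)
  to ok i j rewrite look i | look j with <-cmp (toℕ i) (toℕ j)
  ... | tri< i<j _ _ = not-injective (trans (sym (value<ᵇ-forward π ps layπ _ _ (inc i j i<j)))
          (trans (Equivalence.to (induces⇔ σ π v) ok i j) (value<ᵇ-forward σ ls layσ i j i<j)))
  ... | tri≈ _ i≡j _ with refl ← toℕ-injective i≡j = trans (≡ᵇ-refl (bπ (lookup v i))) (sym (≡ᵇ-refl (bσ i)))
  ... | tri> _ _ j<i = trans (sym (value<ᵇ-backward π ps layπ _ _ (inc j i j<i)))
          (trans (Equivalence.to (induces⇔ σ π v) ok i j) (value<ᵇ-backward σ ls layσ j i j<i))
  from : SamePattern ls (Vec.map bπ v) → induces σ π v ≡ true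
  from same = Equivalence.from (induces⇔ σ π v) go
    where
    same′ : ∀ i j → (bπ (lookup v i) ≡ᵇ bπ (lookup v j)) ≡ (bσ i ≡ᵇ bσ j)
    same′ i j = subst₂ (λ x y → (x ≡ᵇ y) ≡ (bσ i ≡ᵇ bσ j)) (look i) (look j) (same i j)
    go : ∀ i j → (toℕ (π ⟨$⟩ʳ lookup v i) <ᵇ toℕ (π ⟨$⟩ʳ lookup v j)) ≡ (toℕ (σ ⟨$⟩ʳ i) <ᵇ toℕ (σ ⟨$⟩ʳ j))
    go i j with <-cmp (toℕ i) (toℕ j)
    ... | tri< i<j _ _ = trans (value<ᵇ-forward π ps layπ _ _ (inc i j i<j))
            (trans (cong not (same′ i j)) (sym (value<ᵇ-forward σ ls layσ i j i<j)))
    ... | tri≈ _ i≡j _ with refl ← toℕ-injective i≡j =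
            trans (<ᵇ-irrefl (toℕ (π ⟨$⟩ʳ lookup v i))) (sym (<ᵇ-irrefl (toℕ (σ ⟨$⟩ʳ i))))
    ... | tri> _ _ j<i = trans (value<ᵇ-backward π ps layπ _ _ (inc j i j<i))
            (trans (same′ i j) (sym (value<ᵇ-backward σ ls layσ j i j<i)))

choose-All : ∀ {A : Set} {Q : A → Set} m {xs} → All Q xs → All (λ (v : Vec A m) → ∀ i → Q (lookup v i)) (choose m xs)
choose-All zero    _        = (λ ()) ∷ []
choose-All (suc m) []       = []
choose-All (suc m) (q ∷ qs) = ++⁺
  (map⁺ (All.map (λ { h zero → q ; h (suc i) → h i }) (choose-All m qs)))
  (choose-All (suc m) qs)

choose-increasing : ∀ {n} m {xs : List (Fin n)} → AllPairs Fin._<_ xs → All (Increasing {m}) (choose m xs)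
choose-increasing zero    _        = (λ ()) ∷ []
choose-increasing (suc m) []       = []
choose-increasing (suc m) (q ∷ qs) = ++⁺
  (map⁺ (All.zipWith (λ { (h , inc) zero    (suc j) _         → h j
                            ; (h , inc) (suc i) (suc j) (s≤s i<j) → inc i j i<j })
                         (choose-All m q , choose-increasing m qs)))
  (choose-increasing (suc m) qs)

-- Positions are replaced by their layer indices. This commutes with `choose`, so the host becomes
-- the word `labels 0 ps`, whose matching subwords obey the recursion of `count`.
occurrences≡count : ∀ {m n ls ps} (σ : Perm m) (π : Perm n) → IsLayered σ ls → IsLayered π ps →
  occurrences σ π ≡ count ls ps
occurrences≡count {ls = ls} {ps} σ π layσ@(refl , pos , _) layπ@(refl , _) = begin-equality
  occurrences σ π
    ≡⟨ length-filterᵇ (induces σ π) (choose m (allFin n)) ⟩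
  tally (induces σ π) (choose m (allFin n))
    ≡⟨ tally-cong (All.map agree (choose-increasing m (AllPairs.tabulate⁺-< id))) ⟩
  tally (matches ls ∘ Vec.map label) (choose m (allFin n))
    ≡⟨ sym (tally-map (matches ls) (Vec.map label) (choose m (allFin n))) ⟩
  tally (matches ls) (map (Vec.map label) (choose m (allFin n)))
    ≡⟨ cong (tally (matches ls)) (sym (choose-map label m (allFin n))) ⟩
  tally (matches ls) (choose m (map label (allFin n)))
    ≡⟨ cong (tally (matches ls) ∘ choose m) (trans (map-tabulate id label) (blockOf-labels 0 ps)) ⟩
  tally (matches ls) (choose m (labels 0 ps))
    ≡⟨ tally-labels pos 0 ps ⟩
  count ls ps ∎
  where
  m = sum ls
  n = sum ps
  label : Fin n → ℕ
  label x = blockOf ps (toℕ x)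
  agree : ∀ {v} → Increasing v → induces σ π v ≡ matches ls (Vec.map label v)
  agree {v} inc = ⇔→≡ (mk⇔
    (λ ok → Equivalence.from matched (Equivalence.to same ok))
    (λ ok → Equivalence.from same (Equivalence.to matched ok)))
    where
    same = induces⇔same σ π layσ layπ v inc
    matched = matches-same pos (Vec.map label v) (λ i j i<j → subst₂ _≤_
      (sym (lookup-map i label v)) (sym (lookup-map j label v)) (blockOf-mono ps (<⇒≤ (inc i j i<j))))

-- From densities to occurrence counts

/-cancel-≤ : ∀ x y d → (ℤ.+ x ℚ./ suc d) ℚ.≤ (ℤ.+ y ℚ./ suc d) → x ≤ y
-- The rational quotient is reduced to lowest terms; unnormalised fractions keep the common
-- denominator.
/-cancel-≤ x y d le = ℤ.drop‿+≤+ (ℤ.*-cancelʳ-≤-pos (ℤ.+ x) (ℤ.+ y) (ℤ.+ suc d) (ℚᵘ.drop-*≤*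
  (ℚᵘ.≤-respʳ-≃ (ℚ.toℚᵘ-fromℚᵘ (ℚᵘ.mkℚᵘ (ℤ.+ y) d))
    (ℚᵘ.≤-respˡ-≃ (ℚ.toℚᵘ-fromℚᵘ (ℚᵘ.mkℚᵘ (ℤ.+ x) d)) (ℚ.toℚᵘ-mono-≤ le)))))

density-cancel-≤ : ∀ {m n} (σ : Perm m) (π π′ : Perm n) → m ≤ n →
  density σ π′ ℚ.≤ density σ π → occurrences σ π′ ≤ occurrences σ π
-- `C-positive` excludes the branch with the default density 0.
density-cancel-≤ {m} {n} σ π π′ m≤n le with n C m | C-positive n m m≤n
... | suc c | _ = /-cancel-≤ (occurrences σ π′) (occurrences σ π) c le

optimal⇒maximal : ∀ {m n ls ps} (σ : Perm m) (π : Perm n) → IsLayered σ ls → IsLayered π ps →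
  Optimal σ π → Maximal ls ps
optimal⇒maximal {ls = ls} {ps} σ π layσ layπ@(refl , _) (m≤n , best) q pos-q sum≡ = subst₂ _≤_
  (occurrences≡count σ π′ layσ layπ′) (occurrences≡count σ π layσ layπ)
  (density-cancel-≤ σ π π′ m≤n (best π′))
  where
  competitor : ∃[ π′ ] IsLayered {sum ps} π′ q
  competitor = subst (λ n → ∃[ π′ ] IsLayered {n} π′ q) sum≡ (layered q , layered-isLayered q pos-q)
  π′ = proj₁ competitor
  layπ′ = proj₂ competitor

-- From vectors to lists, and the theorem

toList-last : ∀ {A : Set} {n} (v : Vec A (suc n)) → ∃[ front ] toList v ≡ front ++ [ last v ]
toList-last (x ∷ [])     = [] , refl
toList-last (x ∷ y ∷ v) =
  let front , eq = toList-last (y ∷ v) in x ∷ front , cong (x ∷_) eq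

toList-linked : ∀ {A : Set} {R : A → A → Set} {n} (v : Vec A (suc n)) →
  ((i : Fin n) → R (lookup v (inject₁ i)) (lookup v (fsuc i))) → Linked R (toList v)
toList-linked (x ∷ [])    r = [-]
toList-linked (x ∷ y ∷ v) r = r zero ∷ toList-linked (y ∷ v) (λ i → r (fsuc i))

theorem1p6 : (k : ℕ) (ℓ : Vec ℕ (suc (suc k))) {m : ℕ} (σ : Perm m) →
    IsLayered σ (toList ℓ) →
    head ℓ ≡ last ℓ →
    2 ≤ head ℓ →
    ((i : Fin (suc k)) → lookup ℓ (inject₁ i) ≡ head ℓ ⊎ lookup ℓ (fsuc i) ≡ head ℓ) →
    ∃[ K ] ((n : ℕ) (π : Perm n) (ℓs : List ℕ) →
    IsLayered π ℓs → Optimal σ π → length ℓs ≤ K)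
theorem1p6 k ℓ@(suc (suc j) ∷ ℓ′) σ layσ@(refl , pos , _) head≡last (s≤s (s≤s _)) adj =
  bound , λ { n π ps layπ@(refl , pos-p , _) opt →
    few-layers ps pos-p (optimal⇒maximal σ π layσ layπ opt) (proj₁ opt) }
  where
  front : List ℕ
  front = proj₁ (toList-last ℓ)
  ends : toList ℓ ≡ front ++ [ 2 + j ]
  ends = trans (proj₂ (toList-last ℓ)) (cong (λ x → front ++ [ x ]) (sym head≡last))
  open Bounded j (toList ℓ′) front ends pos (toList-linked ℓ adj)
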